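{- State reachability is undecidable in time-ahead $\mu$Stipula ($\mu$Stipula$^{\tt TA}$): there is no algorithm that, given a $\mu$Stipula$^{\tt TA}$ contract ${\tt C}$ and a state ${\tt Q}$, decides whether ${\tt Q}$ is reachable in ${\tt C}$.
   Context: A $\mu$Stipula contract ${\tt C}$ consists of a finite set of states, an initial state ${\tt Q}_{\rm init}$, and a finite set of functions. A function has the form $@{\tt Q}\; {\tt f}\,\{W\} \Rightarrow @{\tt Q}'$ (invocable in state ${\tt Q}$, leading to state ${\tt Q}'$), where $W$ is a finite sequence of events; an event has the form ${\tt now}+k \gg @{\tt Q}_1 \Rightarrow @{\tt Q}_2$ with $k\in\mathbb{N}$, and each event occurrence carries a unique line index $n$. A pending event is a term $k \gg_n {\tt Q}_1 \Rightarrow {\tt Q}_2$. A configuration is ${\tt C}({\tt Q},\Sigma,\Psi)$ where ${\tt Q}$ is a state, $\Psi$ is a finite multiset of pending events (written with $|$, empty multiset $\_$), and $\Sigma$ is either empty ($\_$) or of the form $\Psi'\Rightarrow{\tt Q}'$. (Configurations also carry a clock incremented by Tick, irrelevant for reachability.) Let $\mathit{nored}(\Psi,{\tt Q})$ hold iff $\Psi$ contains no pending event $0\gg_n {\tt Q}\Rightarrow {\tt Q}'$. Let $\Psi\!\downarrow$ delete all pending events with time $0$ and decrement the time of all others by one. Transitions: (Function) if $@{\tt Q}\,{\tt f}\{W\}\Rightarrow@{\tt Q}'$ is in ${\tt C}$ and $\mathit{nored}(\Psi,{\tt Q})$, then ${\tt C}({\tt Q},\_,\Psi)\to{\tt C}({\tt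 Q},\Psi_W\Rightarrow{\tt Q}',\Psi)$, where $\Psi_W$ is the multiset of $k\gg_n{\tt Q}_1\Rightarrow{\tt Q}_2$ for each event ${\tt now}+k\gg@{\tt Q}_1\Rightarrow@{\tt Q}_2$ (line $n$) in $W$; (State-Change) ${\tt C}({\tt Q},\Psi'\Rightarrow{\tt Q}',\Psi)\to{\tt C}({\tt Q}',\_,\Psi'|\Psi)$; (Event-Match) ${\tt C}({\tt Q},\_,0\gg_n{\tt Q}\Rightarrow{\tt Q}'\,|\,\Psi')\to{\tt C}({\tt Q},\_\Rightarrow{\tt Q}',\Psi')$; (Tick) if $\mathit{nored}(\Psi,{\tt Q})$ then ${\tt C}({\tt Q},\_,\Psi)\to{\tt C}({\tt Q},\_,\Psi\!\downarrow)$. The initial configuration is ${\tt C}({\tt Q}_{\rm init},\_,\_)$. A state ${\tt Q}$ is reachable in ${\tt C}$ iff ${\tt C}({\tt Q}_{\rm init},\_,\_)\to^*{\tt C}({\tt Q},\_,\Psi)$ for some $\Psi$. The fragment $\mu$Stipula$^{\tt TA}$ consists of contracts in which every event has time expression ${\tt now}+k$ with $k>0$. -}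

module Defs where

open import Data.Nat using (ℕ; zero; suc; _<_)
open import Data.Fin using (Fin)
open import Data.Vec using (Vec; []; _∷_; lookup; updateAt)
open import Data.List using (List; []; _∷_; _++_; map; concatMap)
open import Data.List.Relation.Unary.All using (All)
open import Data.List.Relation.Unary.Unique.Propositional using (Unique)
open import Data.List.Membership.Propositional using (_∈_)
open import Data.List.Relation.Binary.Permutation.Propositional using (_↭_)
open import Data.Maybe using (Maybe; just; nothing)
open import Data.Product using (_×_; _,_; ∃; Σ)
open import Relation.Nullary using (¬_)
open import Relation.Binary.PropositionalEquality using (_≡_)
open import Relation.Binary.Construct.Closure.ReflexiveTransitive using (Star)

State : Set
State = ℕ

-- An event occurrence  now + time ≫ @src ⇒ @tgt  at line index `line`.
record Event : Set where
  constructor ev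
  field
    line : ℕ
    time : ℕ
    src  : State
    tgt  : State
open Event public

record Fun : Set where
  constructor fn
  field
    from   : State
    events : List Event
    to     : State
open Fun public

record Contract : Set where
  constructor contract
  field
    init      : State
    functions : List Fun
open Contract public

lines : Contract → List ℕ
lines C = concatMap (λ f → map line (events f)) (functions C)

IsTA : Contract → Set
IsTA C = All (λ f → All (λ e → 0 < time e) (events f)) (functions C)
       × Unique (lines C)

-- A pending event  k ≫ₙ Q₁ ⇒ Q₂  is represented by an Event record
-- (line = n, time = k, src = Q₁, tgt = Q₂). Multisets are lists taken
-- up to permutation (_↭_).
Pending : Set
Pending = Event

Multiset : Set
Multiset = List Pending

-- Configuration C(Q, Σ, Ψ); Σ = nothing is "_", Σ = just (Ψ' , Q') is Ψ' ⇒ Q'.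
-- (The clock is omitted: irrelevant for reachability.)
record Config : Set where
  constructor ⟨_,_,_⟩
  field
    st  : State
    sig : Maybe (Multiset × State)
    psi : Multiset

nored : Multiset → State → Set
nored Ψ Q = All (λ p → ¬ (time p ≡ 0 × src p ≡ Q)) Ψ

_↓ : Multiset → Multiset
[] ↓ = []
(ev n zero q₁ q₂ ∷ Ψ) ↓ = Ψ ↓
(ev n (suc k) q₁ q₂ ∷ Ψ) ↓ = ev n k q₁ q₂ ∷ (Ψ ↓)

module _ (C : Contract) where

  data _⟶_ : Config → Config → Set where
    function : ∀ {Q Ψ} (f : Fun) → f ∈ functions C → from f ≡ Q → nored Ψ Q →
               ⟨ Q , nothing , Ψ ⟩ ⟶ ⟨ Q , just (events f , to f) , Ψ ⟩
    state-change : ∀ {Q Q' Ψ Ψ'} →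
               ⟨ Q , just (Ψ' , Q') , Ψ ⟩ ⟶ ⟨ Q' , nothing , Ψ' ++ Ψ ⟩
    event-match : ∀ {Q Ψ Ψ'} (p : Pending) → Ψ ↭ (p ∷ Ψ') →
               time p ≡ 0 → src p ≡ Q →
               ⟨ Q , nothing , Ψ ⟩ ⟶ ⟨ Q , just ([] , tgt p) , Ψ' ⟩
    tick : ∀ {Q Ψ} → nored Ψ Q →
               ⟨ Q , nothing , Ψ ⟩ ⟶ ⟨ Q , nothing , Ψ ↓ ⟩

Reachable : Contract → State → Set
Reachable C Q = ∃ λ Ψ → Star (_⟶_ C) ⟨ init C , nothing , [] ⟩ ⟨ Q , nothing , Ψ ⟩

-- Two-counter (Minsky) machines: the standard undecidable halting problem.

data Instr : Set where
  inc : Fin 2 → ℕ → Instr          -- r := r + 1; goto j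
  dec : Fin 2 → ℕ → ℕ → Instr      -- if r = 0 then goto z else (r := r - 1; goto j)

Program : Set
Program = List Instr

instrAt : Program → ℕ → Maybe Instr
instrAt []      _       = nothing
instrAt (i ∷ P) zero    = just i
instrAt (i ∷ P) (suc n) = instrAt P n

MConfig : Set
MConfig = ℕ × Vec ℕ 2

data MStep (P : Program) : MConfig → MConfig → Set where
  m-inc  : ∀ {pc r j c} → instrAt P pc ≡ just (inc r j) →
           MStep P (pc , c) (j , updateAt c r suc)
  m-zero : ∀ {pc r z j c} → instrAt P pc ≡ just (dec r z j) → lookup c r ≡ 0 →
           MStep P (pc , c) (z , c)
  m-dec  : ∀ {pc r z j c n} → instrAt P pc ≡ just (dec r z j) → lookup c r ≡ suc n →
           MStep P (pc , c) (j , updateAt c r (λ _ → n))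

Halts : Program → Set
Halts P = Σ MConfig λ cf → Star (MStep P) (0 , 0 ∷ 0 ∷ []) cf × instrAt P (Data.Product.proj₁ cf) ≡ nothing

module Submission where

-- A two-counter machine P is simulated by a contract that runs in rounds, one per machine
-- step, separated by a single tick in the location wait. Register r is stored as the number
-- of up r units minus the number of down r units, a unit being a pair of pending events that
-- become due at the start of a round. Since due events are urgent, the rest of the round is
-- forced: every unit fires from copy and respawns itself for the next round (an increment
-- or decrement adds one more up or down unit), and a zero test alternately consumes up and
-- down compare events until one family runs out. The only remaining freedom is to tick too
-- early; rounds alternate a parity bit tagging their locations, and every round arms, for
-- each location of the next round, a guard event to dead that is due exactly after such a
-- premature tick. Thus halt is reachable iff P halts: a halting computation is replayed
-- round by round, and conversely an invariant on all reachable configurations shows that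
-- halt is only entered by a jump out of the program from a reachable machine configuration.

open import Defs
open import Data.Bool using (Bool; true; false; not; if_then_else_)
open import Data.Bool.Properties using (not-¬)
open import Data.Empty using (⊥; ⊥-elim)
open import Data.Fin using (Fin)
import Data.Fin as F
open import Data.Fin.Patterns using (0F; 1F)
open import Data.List using (List; []; _∷_; _++_; map; concatMap; length)
open import Data.List.Properties using (map-++; ++-assoc; ++-identityʳ)
open import Data.List.Membership.Propositional using (_∈_)
open import Data.List.Membership.Propositional.Properties
  using (∈-++⁺ˡ; ∈-++⁺ʳ; ∈-++⁻; ∈-map⁺; ∈-map⁻; ∈-∃++; ∈-concatMap⁺; ∈-concatMap⁻)
open import Data.List.Relation.Unary.All using (All; []; _∷_)
import Data.List.Relation.Unary.All as All
import Data.List.Relation.Unary.All.Properties as All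
import Data.List.Relation.Unary.AllPairs as AllPairs
open import Data.List.Relation.Unary.Any using (here; there)
import Data.List.Relation.Unary.Any as Any
open import Data.List.Relation.Unary.Unique.Propositional using (Unique)
open import Data.List.Relation.Binary.Permutation.Propositional
  using (_↭_; ↭-refl; ↭-sym; ↭-trans; ↭-reflexive; ↭-prep; ↭-swap)
import Data.List.Relation.Binary.Permutation.Propositional as Perm
open import Data.List.Relation.Binary.Permutation.Propositional.Properties
  using (All-resp-↭; ∈-resp-↭; ++⁺; ++⁺ˡ; ++⁺ʳ; shift; shifts; drop-∷; ¬x∷xs↭[])
  renaming (map⁺ to ↭-map⁺; ++-comm to ↭-++-comm)
open import Data.Maybe using (Maybe; just; nothing)
open import Data.Nat using (ℕ; zero; suc; _+_; _∸_; _≤_; _<_; z≤n; s≤s; s≤s⁻¹)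
open import Data.Nat.Binary as ℕᵇ using (ℕᵇ; 2[1+_]; 1+[2_]; toℕ)
open import Data.Nat.Binary.Properties using (toℕ-injective)
open import Data.Nat.Properties
open import Data.Product using (Σ; _×_; proj₁; proj₂; _,_; map₁; ∃)
open import Data.Sum using (_⊎_; inj₁; inj₂)
open import Data.Vec using (Vec; []; _∷_; lookup; updateAt)
open import Function using (_∘_)
open import Function.Bundles using (_⇔_; mk⇔)
open import Relation.Binary.Construct.Closure.ReflexiveTransitive using (Star; ε; _◅_; _◅◅_)
open import Relation.Binary.Definitions using (DecidableEquality)
open import Relation.Binary.PropositionalEquality
open import Relation.Nullary using (¬_; yes; no; does)
open import Relation.Nullary.Decidable using (map′)

-- up r and down r count the increments and the decrements of register r.
data Family : Set where
  up down : Fin 2 → Family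

data Stage : Set where
  copy dispatch : Stage
  copied compare compared exhausted : Family → Stage

data Branch : Set where
  onInc onZero onDec : Branch

data Loc : Set where
  dead halt wait boot : Loc
  round : Bool → Stage → Loc
  instr : Bool → Branch → ℕ → Loc

module Encoding where

  Writer Reader : Set → Set
  Writer A = A → ℕᵇ → ℕᵇ
  Reader A = ℕᵇ → A × ℕᵇ

  RoundTrip : {A : Set} → Writer A → Reader A → Set
  RoundTrip wr rd = ∀ a w → rd (wr a w) ≡ (a , w)

  O I : ℕᵇ → ℕᵇ
  O = 1+[2_]
  I = 2[1+_]

  writeBool : Writer Bool
  writeBool false = O
  writeBool true  = I

  readBool : Reader Bool
  readBool (1+[2 w ]) = false , w
  readBool (2[1+ w ]) = true , w
  readBool ℕᵇ.zero    = false , ℕᵇ.zero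

  readBool-writeBool : RoundTrip writeBool readBool
  readBool-writeBool false w = refl
  readBool-writeBool true  w = refl

  writeℕ : Writer ℕ
  writeℕ zero    = O
  writeℕ (suc n) = λ w → I (writeℕ n w)

  readℕ : Reader ℕ
  readℕ (1+[2 w ]) = 0 , w
  readℕ (2[1+ w ]) = map₁ suc (readℕ w)
  readℕ ℕᵇ.zero    = 0 , ℕᵇ.zero

  readℕ-writeℕ : RoundTrip writeℕ readℕ
  readℕ-writeℕ zero    w = refl
  readℕ-writeℕ (suc n) w = cong (map₁ suc) (readℕ-writeℕ n w)

  writeFamily : Writer Family
  writeFamily (up 0F)         = λ w → O (O w)
  writeFamily (up (1F)) = λ w → O (I w)
  writeFamily (down 0F)         = λ w → I (O w)
  writeFamily (down (1F)) = λ w → I (I w)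

  readFamily : Reader Family
  readFamily (1+[2 1+[2 w ] ]) = up 0F , w
  readFamily (1+[2 2[1+ w ] ]) = up (1F) , w
  readFamily (2[1+ 1+[2 w ] ]) = down 0F , w
  readFamily (2[1+ 2[1+ w ] ]) = down (1F) , w
  readFamily w                 = up 0F , w

  readFamily-writeFamily : RoundTrip writeFamily readFamily
  readFamily-writeFamily (up 0F)           w = refl
  readFamily-writeFamily (up (1F))   w = refl
  readFamily-writeFamily (down 0F)         w = refl
  readFamily-writeFamily (down (1F)) w = refl

  writeStage : Writer Stage
  writeStage copy            = λ w → O (O w)
  writeStage dispatch        = λ w → O (I w)
  writeStage (copied φ)      = λ w → I (O (O (writeFamily φ w)))
  writeStage (compare φ)     = λ w → I (O (I (writeFamily φ w)))
  writeStage (compared φ)    = λ w → I (I (O (writeFamily φ w)))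
  writeStage (exhausted φ)   = λ w → I (I (I (writeFamily φ w)))

  readStage : Reader Stage
  readStage (1+[2 1+[2 w ] ])          = copy , w
  readStage (1+[2 2[1+ w ] ])          = dispatch , w
  readStage (2[1+ 1+[2 1+[2 w ] ] ]) = map₁ copied (readFamily w)
  readStage (2[1+ 1+[2 2[1+ w ] ] ]) = map₁ compare (readFamily w)
  readStage (2[1+ 2[1+ 1+[2 w ] ] ]) = map₁ compared (readFamily w)
  readStage (2[1+ 2[1+ 2[1+ w ] ] ]) = map₁ exhausted (readFamily w)
  readStage w                          = copy , w

  readStage-writeStage : RoundTrip writeStage readStage
  readStage-writeStage copy          w = refl
  readStage-writeStage dispatch      w = refl
  readStage-writeStage (copied φ)    w = cong (map₁ copied) (readFamily-writeFamily φ w)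
  readStage-writeStage (compare φ)   w = cong (map₁ compare) (readFamily-writeFamily φ w)
  readStage-writeStage (compared φ)  w = cong (map₁ compared) (readFamily-writeFamily φ w)
  readStage-writeStage (exhausted φ) w = cong (map₁ exhausted) (readFamily-writeFamily φ w)

  writeBranch : Writer Branch
  writeBranch onInc  = O
  writeBranch onZero = λ w → I (O w)
  writeBranch onDec  = λ w → I (I w)

  readBranch : Reader Branch
  readBranch (1+[2 w ])         = onInc , w
  readBranch (2[1+ 1+[2 w ] ]) = onZero , w
  readBranch (2[1+ 2[1+ w ] ]) = onDec , w
  readBranch w                  = onInc , w

  readBranch-writeBranch : RoundTrip writeBranch readBranch
  readBranch-writeBranch onInc  w = refl
  readBranch-writeBranch onZero w = refl
  readBranch-writeBranch onDec  w = refl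

  writeLoc : Writer Loc
  writeLoc dead           = λ w → O (O (O w))
  writeLoc halt           = λ w → O (O (I w))
  writeLoc wait           = λ w → O (I (O w))
  writeLoc boot           = λ w → O (I (I w))
  writeLoc (round β g)    = λ w → I (O (writeBool β (writeStage g w)))
  writeLoc (instr β k pc) = λ w → I (I (writeBool β (writeBranch k (writeℕ pc w))))

  readLoc : Reader Loc
  readLoc (1+[2 1+[2 1+[2 w ] ] ]) = dead , w
  readLoc (1+[2 1+[2 2[1+ w ] ] ]) = halt , w
  readLoc (1+[2 2[1+ 1+[2 w ] ] ]) = wait , w
  readLoc (1+[2 2[1+ 2[1+ w ] ] ]) = boot , w
  readLoc (2[1+ 1+[2 w ] ]) =
    let (β , w₁) = readBool w ; (g , w₂) = readStage w₁ in round β g , w₂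
  readLoc (2[1+ 2[1+ w ] ]) =
    let (β , w₁) = readBool w ; (k , w₂) = readBranch w₁ ; (pc , w₃) = readℕ w₂ in instr β k pc , w₃
  readLoc w = dead , w

  readLoc-writeLoc : RoundTrip writeLoc readLoc
  readLoc-writeLoc dead w = refl
  readLoc-writeLoc halt w = refl
  readLoc-writeLoc wait w = refl
  readLoc-writeLoc boot w = refl
  readLoc-writeLoc (round β g) w
    rewrite readBool-writeBool β (writeStage g w) | readStage-writeStage g w = refl
  readLoc-writeLoc (instr β k pc) w
    rewrite readBool-writeBool β (writeBranch k (writeℕ pc w))
          | readBranch-writeBranch k (writeℕ pc w) | readℕ-writeℕ pc w = refl

  -- Opaque because normal forms of enc on open terms grow exponentially in the word length.
  opaque
    enc : Loc → State
    enc s = toℕ (writeLoc s ℕᵇ.zero)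

    enc-injective : ∀ {s t} → enc s ≡ enc t → s ≡ t
    enc-injective {s} {t} e =
      cong proj₁ (trans (sym (readLoc-writeLoc s ℕᵇ.zero))
                        (trans (cong readLoc (toℕ-injective e)) (readLoc-writeLoc t ℕᵇ.zero)))

  enc-distinct : ∀ {s t} → s ≢ t → enc s ≢ enc t
  enc-distinct s≢t e = s≢t (enc-injective e)

open Encoding using (enc; enc-injective; enc-distinct)

module Registers where

  _≟ᶠ_ : DecidableEquality Family
  up r   ≟ᶠ up s   = map′ (cong up) (λ { refl → refl }) (r F.≟ s)
  up _   ≟ᶠ down _ = no λ ()
  down _ ≟ᶠ up _   = no λ ()
  down r ≟ᶠ down s = map′ (cong down) (λ { refl → refl }) (r F.≟ s)

  flip : Family → Family
  flip (up r)   = down r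
  flip (down r) = up r

  Counts : Set
  Counts = Family → ℕ

  _[_≔_] : Counts → Family → ℕ → Counts
  (c [ φ ≔ v ]) ψ = if does (φ ≟ᶠ ψ) then v else c ψ

  update-same : ∀ c φ v → (c [ φ ≔ v ]) φ ≡ v
  update-same c φ v with φ ≟ᶠ φ
  ... | yes _   = refl
  ... | no φ≢φ = ⊥-elim (φ≢φ refl)

  update-other : ∀ c {φ ψ} v → φ ≢ ψ → (c [ φ ≔ v ]) ψ ≡ c ψ
  update-other c {φ} {ψ} v φ≢ψ with φ ≟ᶠ ψ
  ... | yes φ≡ψ = ⊥-elim (φ≢ψ φ≡ψ)
  ... | no _    = refl

  update-restore : ∀ c φ v ψ → ((c [ φ ≔ v ]) [ φ ≔ c φ ]) ψ ≡ c ψ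
  update-restore c φ v ψ with φ ≟ᶠ ψ
  ... | yes refl = refl
  ... | no _     = refl

  update-suc-≥ : ∀ c φ ψ → c ψ ≤ (c [ φ ≔ suc (c φ) ]) ψ
  update-suc-≥ c φ ψ with φ ≟ᶠ ψ
  ... | yes refl = n≤1+n (c φ)
  ... | no _     = ≤-refl

  total : Counts → ℕ
  total c = c (up 0F) + (c (down 0F) + (c (up 1F) + c (down 1F)))

  total-update : ∀ c φ k → c φ ≡ suc k → total c ≡ suc (total (c [ φ ≔ k ]))
  total-update c (up 0F)   k e rewrite e = refl
  total-update c (down 0F) k e rewrite e = +-suc (c (up 0F)) _
  total-update c (up 1F)   k e rewrite e =
    trans (cong (c (up 0F) +_) (+-suc (c (down 0F)) _)) (+-suc (c (up 0F)) _)
  total-update c (down 1F) k e rewrite e =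
    trans (cong (λ x → c (up 0F) + (c (down 0F) + x)) (+-suc (c (up 1F)) k))
          (trans (cong (c (up 0F) +_) (+-suc (c (down 0F)) _)) (+-suc (c (up 0F)) _))

  empty-or-positive : ∀ (c : Counts) → (∀ φ → c φ ≡ 0) ⊎ (∃ λ φ → ∃ λ k → c φ ≡ suc k)
  empty-or-positive c with c (up 0F) in e₀ | c (down 0F) in e₁ | c (up 1F) in e₂ | c (down 1F) in e₃
  ... | suc k | _     | _     | _     = inj₂ (up 0F , k , e₀)
  ... | zero  | suc k | _     | _     = inj₂ (down 0F , k , e₁)
  ... | zero  | zero  | suc k | _     = inj₂ (up 1F , k , e₂)
  ... | zero  | zero  | zero  | suc k = inj₂ (down 1F , k , e₃)
  ... | zero  | zero  | zero  | zero  =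
    inj₁ λ { (up 0F) → e₀ ; (down 0F) → e₁ ; (up 1F) → e₂ ; (down 1F) → e₃ }

  Split : Counts → Counts → Counts → Set
  Split rest done c = ∀ φ → rest φ + done φ ≡ c φ

  Split-move : ∀ {rest done c φ k} → Split rest done c → rest φ ≡ suc k →
               Split (rest [ φ ≔ k ]) (done [ φ ≔ suc (done φ) ]) c
  Split-move {rest} {done} {c} {φ} {k} sp e ψ with φ ≟ᶠ ψ
  ... | yes refl = trans (+-suc k (done φ)) (trans (cong (_+ done φ) (sym e)) (sp φ))
  ... | no _     = sp ψ

  value : Counts → Fin 2 → ℕ
  value c r = c (up r) ∸ c (down r)

  registers : Counts → Vec ℕ 2
  registers c = value c 0F ∷ value c 1F ∷ []

  lookup-registers : ∀ c r → lookup (registers c) r ≡ value c r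
  lookup-registers c 0F = refl
  lookup-registers c 1F = refl

  registers-update : ∀ {c c′} r f → value c′ r ≡ f (value c r) → (∀ s → s ≢ r → value c′ s ≡ value c s) →
                     registers c′ ≡ updateAt (registers c) r f
  registers-update 0F f e other = cong₂ _∷_ e (cong (_∷ []) (other 1F λ ()))
  registers-update 1F f e other = cong₂ _∷_ (other 0F λ ()) (cong (_∷ []) e)

  Balanced : Counts → Set
  Balanced c = ∀ r → c (down r) ≤ c (up r)

  increment decrement : Counts → Fin 2 → Counts
  increment c r = c [ up r ≔ suc (c (up r)) ]
  decrement c r = c [ down r ≔ suc (c (down r)) ]

  Balanced-increment : ∀ c r → Balanced c → Balanced (increment c r)
  Balanced-increment c r bal s = ≤-trans (bal s) (update-suc-≥ c (up r) (up s))

  registers-increment : ∀ c r → Balanced c → registers (increment c r) ≡ updateAt (registers c) r suc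
  registers-increment c r bal = registers-update {c} {increment c r} r suc this others
    where
    this : value (increment c r) r ≡ suc (value c r)
    this rewrite update-same c (up r) (suc (c (up r))) = +-∸-assoc 1 (bal r)
    others : ∀ s → s ≢ r → value (increment c r) s ≡ value c s
    others s s≢r = cong (_∸ c (down s)) (update-other c {up r} {up s} _ λ { refl → s≢r refl })

  Balanced-decrement : ∀ c {x} r → Balanced c → suc x + c (down r) ≡ c (up r) → Balanced (decrement c r)
  Balanced-decrement c {x} r bal e s with r F.≟ s
  ... | yes refl = subst (suc (c (down r)) ≤_) e (s≤s (m≤n+m (c (down r)) x))
  ... | no _     = bal s

  registers-decrement : ∀ c {x} r → suc x + c (down r) ≡ c (up r) →
                        registers (decrement c r) ≡ updateAt (registers c) r (λ _ → x)
  registers-decrement c {x} r e = registers-update {c} {decrement c r} r (λ _ → x) this others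
    where
    this : value (decrement c r) r ≡ x
    this rewrite update-same c (down r) (suc (c (down r))) =
      trans (cong (_∸ suc (c (down r))) (sym (trans (+-suc x (c (down r))) e)))
            (m+n∸n≡m x (suc (c (down r))))
    others : ∀ s → s ≢ r → value (decrement c r) s ≡ value c s
    others s s≢r = cong (c (up s) ∸_) (update-other c {down r} {down s} _ λ { refl → s≢r refl })

  lookup-registers-suc : ∀ c {x} r → suc x + c (down r) ≡ c (up r) → lookup (registers c) r ≡ suc x
  lookup-registers-suc c {x} r e =
    trans (lookup-registers c r) (trans (cong (_∸ c (down r)) (sym e)) (m+n∸n≡m (suc x) (c (down r))))

  lookup-registers-zero : ∀ c r → c (down r) ≡ c (up r) → lookup (registers c) r ≡ 0
  lookup-registers-zero c r e = trans (lookup-registers c r) (trans (cong (c (up r) ∸_) e) (n∸n≡0 (c (up r))))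

open Registers

module FamilyBags {A : Set} where

  copies : ℕ → List A → List A
  copies zero    xs = []
  copies (suc n) xs = xs ++ copies n xs

  byFamily : Counts → (Family → List A) → List A
  byFamily c f = copies (c (up 0F)) (f (up 0F)) ++ (copies (c (down 0F)) (f (down 0F))
               ++ (copies (c (up 1F)) (f (up 1F)) ++ copies (c (down 1F)) (f (down 1F))))

  bring-front : ∀ (X : List A) {B t B′} → B ↭ t ∷ B′ → X ++ B ↭ t ∷ (X ++ B′)
  bring-front X {B} {t} {B′} h = ↭-trans (++⁺ˡ X h) (shift t X B′)

  copies-All : ∀ {Q : A → Set} n {xs} → All Q xs → All Q (copies n xs)
  copies-All zero    qs = []
  copies-All (suc n) qs = All.++⁺ qs (copies-All n qs)

  byFamily-All : ∀ {Q : A → Set} c (f : Family → List A) → (∀ φ → All Q (f φ)) → All Q (byFamily c f)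
  byFamily-All c f qs = All.++⁺ (copies-All (c (up 0F)) (qs _)) (All.++⁺ (copies-All (c (down 0F)) (qs _))
                       (All.++⁺ (copies-All (c (up 1F)) (qs _)) (copies-All (c (down 1F)) (qs _))))

  copies-∈ : ∀ n {xs} {x : A} → x ∈ copies n xs → x ∈ xs × ∃ λ k → n ≡ suc k
  copies-∈ (suc n) {xs} m with ∈-++⁻ xs m
  ... | inj₁ m₁ = m₁ , n , refl
  ... | inj₂ m₂ = proj₁ (copies-∈ n m₂) , n , refl

  byFamily-∈ : ∀ c {f : Family → List A} {x} → x ∈ byFamily c f → ∃ λ φ → x ∈ f φ × ∃ λ k → c φ ≡ suc k
  byFamily-∈ c {f} m with ∈-++⁻ (copies (c (up 0F)) (f (up 0F))) m
  ... | inj₁ m₁ = up 0F , copies-∈ _ m₁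
  ... | inj₂ m₂ with ∈-++⁻ (copies (c (down 0F)) (f (down 0F))) m₂
  ... | inj₁ m₃ = down 0F , copies-∈ _ m₃
  ... | inj₂ m₄ with ∈-++⁻ (copies (c (up 1F)) (f (up 1F))) m₄
  ... | inj₁ m₅ = up 1F , copies-∈ _ m₅
  ... | inj₂ m₆ = down 1F , copies-∈ _ m₆

  byFamily-cong : ∀ {c c′} (f : Family → List A) → (∀ φ → c φ ≡ c′ φ) → byFamily c f ≡ byFamily c′ f
  byFamily-cong f e rewrite e (up 0F) | e (down 0F) | e (up 1F) | e (down 1F) = refl

  byFamily-empty : ∀ {c} (f : Family → List A) → (∀ φ → c φ ≡ 0) → byFamily c f ≡ []
  byFamily-empty f e rewrite e (up 0F) | e (down 0F) | e (up 1F) | e (down 1F) = refl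

  byFamily-take : ∀ c (f : Family → List A) φ k → c φ ≡ suc k → byFamily c f ↭ f φ ++ byFamily (c [ φ ≔ k ]) f
  byFamily-take c f (up 0F) k e rewrite e = ↭-reflexive (++-assoc (f (up 0F)) _ _)
  byFamily-take c f (down 0F) k e rewrite e =
    ↭-trans (++⁺ˡ (copies (c (up 0F)) (f (up 0F))) (↭-reflexive (++-assoc (f (down 0F)) _ _)))
            (shifts (copies (c (up 0F)) (f (up 0F))) (f (down 0F)))
  byFamily-take c f (up 1F) k e rewrite e =
    ↭-trans (++⁺ˡ (copies (c (up 0F)) (f (up 0F))) (++⁺ˡ (copies (c (down 0F)) (f (down 0F)))
              (↭-reflexive (++-assoc (f (up 1F)) _ _))))
     (↭-trans (++⁺ˡ (copies (c (up 0F)) (f (up 0F))) (shifts (copies (c (down 0F)) (f (down 0F))) (f (up 1F))))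
       (shifts (copies (c (up 0F)) (f (up 0F))) (f (up 1F))))
  byFamily-take c f (down 1F) k e rewrite e =
    ↭-trans (++⁺ˡ (copies (c (up 0F)) (f (up 0F))) (++⁺ˡ (copies (c (down 0F)) (f (down 0F)))
              (shifts (copies (c (up 1F)) (f (up 1F))) (f (down 1F)))))
     (↭-trans (++⁺ˡ (copies (c (up 0F)) (f (up 0F))) (shifts (copies (c (down 0F)) (f (down 0F))) (f (down 1F))))
       (shifts (copies (c (up 0F)) (f (up 0F))) (f (down 1F))))

  byFamily-put : ∀ c (f : Family → List A) φ → f φ ++ byFamily c f ↭ byFamily (c [ φ ≔ suc (c φ) ]) f
  byFamily-put c f φ = ↭-sym (↭-trans
    (byFamily-take (c [ φ ≔ suc (c φ) ]) f φ (c φ) (update-same c φ (suc (c φ))))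
    (↭-reflexive (cong (f φ ++_) (byFamily-cong f (update-restore c φ (suc (c φ)))))))

  copies-++ : ∀ n (xs ys : List A) → copies n (xs ++ ys) ↭ copies n xs ++ copies n ys
  copies-++ zero    xs ys = ↭-refl
  copies-++ (suc n) xs ys =
    ↭-trans (↭-reflexive (++-assoc xs ys _))
     (↭-trans (++⁺ˡ xs (++⁺ˡ ys (copies-++ n xs ys)))
      (↭-trans (++⁺ˡ xs (shifts ys (copies n xs))) (↭-reflexive (sym (++-assoc xs (copies n xs) _)))))

  interchange : ∀ (a b c d : List A) → (a ++ b) ++ (c ++ d) ↭ (a ++ c) ++ (b ++ d)
  interchange a b c d = ↭-trans (↭-reflexive (++-assoc a b _))
                        (↭-trans (++⁺ˡ a (shifts b c)) (↭-reflexive (sym (++-assoc a c _))))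

  byFamily-++ : ∀ c (f g : Family → List A) → byFamily c (λ φ → f φ ++ g φ) ↭ byFamily c f ++ byFamily c g
  byFamily-++ c f g =
    ↭-trans (++⁺ (copies-++ (c (up 0F)) _ _) (++⁺ (copies-++ (c (down 0F)) _ _)
              (++⁺ (copies-++ (c (up 1F)) _ _) (copies-++ (c (down 1F)) _ _))))
     (↭-trans (++⁺ˡ (F₀ ++ G₀) (++⁺ˡ (F₁ ++ G₁) (interchange F₂ G₂ F₃ G₃)))
      (↭-trans (++⁺ˡ (F₀ ++ G₀) (interchange F₁ G₁ (F₂ ++ F₃) (G₂ ++ G₃)))
               (interchange F₀ G₀ (F₁ ++ (F₂ ++ F₃)) (G₁ ++ (G₂ ++ G₃)))))
    where
    F₀ F₁ F₂ F₃ G₀ G₁ G₂ G₃ : List A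
    F₀ = copies (c (up 0F)) (f (up 0F))
    F₁ = copies (c (down 0F)) (f (down 0F))
    F₂ = copies (c (up 1F)) (f (up 1F))
    F₃ = copies (c (down 1F)) (f (down 1F))
    G₀ = copies (c (up 0F)) (g (up 0F))
    G₁ = copies (c (down 0F)) (g (down 0F))
    G₂ = copies (c (up 1F)) (g (up 1F))
    G₃ = copies (c (down 1F)) (g (down 1F))

open FamilyBags

Edge : Set
Edge = Loc × Loc

module Triples where

  -- Pending events up to their line index, which the semantics never inspects.
  Triple : Set
  Triple = ℕ × State × State

  delay : Triple → ℕ
  delay = proj₁

  origin goal : Triple → State
  origin t = proj₁ (proj₂ t)
  goal t = proj₂ (proj₂ t)

  strip : Event → Triple
  strip e = time e , src e , tgt e

  pend : ℕ → Edge → Triple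
  pend t (s , q) = t , enc s , enc q

  at : ℕ → List Edge → List Triple
  at t = map (pend t)

  _↓ᵗ : List Triple → List Triple
  [] ↓ᵗ                    = []
  ((zero , s , q) ∷ L) ↓ᵗ  = L ↓ᵗ
  ((suc k , s , q) ∷ L) ↓ᵗ = (k , s , q) ∷ (L ↓ᵗ)

  strip-↓ : ∀ Ψ → map strip (Ψ ↓) ≡ map strip Ψ ↓ᵗ
  strip-↓ []                    = refl
  strip-↓ (ev n zero a b ∷ Ψ)    = strip-↓ Ψ
  strip-↓ (ev n (suc k) a b ∷ Ψ) = cong (_ ∷_) (strip-↓ Ψ)

  ↓ᵗ-++ : ∀ A B → (A ++ B) ↓ᵗ ≡ A ↓ᵗ ++ B ↓ᵗ
  ↓ᵗ-++ []                    B = refl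
  ↓ᵗ-++ ((zero , s , q) ∷ A)  B = ↓ᵗ-++ A B
  ↓ᵗ-++ ((suc k , s , q) ∷ A) B = cong (_ ∷_) (↓ᵗ-++ A B)

  ↓ᵗ-↭ : ∀ {A B} → A ↭ B → A ↓ᵗ ↭ B ↓ᵗ
  ↓ᵗ-↭ Perm.refl                             = ↭-refl
  ↓ᵗ-↭ (Perm.prep (zero , _) h)              = ↓ᵗ-↭ h
  ↓ᵗ-↭ (Perm.prep (suc k , _) h)             = ↭-prep _ (↓ᵗ-↭ h)
  ↓ᵗ-↭ (Perm.swap (zero , _) (zero , _) h)   = ↓ᵗ-↭ h
  ↓ᵗ-↭ (Perm.swap (zero , _) (suc k , _) h)  = ↭-prep _ (↓ᵗ-↭ h)
  ↓ᵗ-↭ (Perm.swap (suc k , _) (zero , _) h)  = ↭-prep _ (↓ᵗ-↭ h)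
  ↓ᵗ-↭ (Perm.swap (suc k , _) (suc l , _) h) = ↭-swap _ _ (↓ᵗ-↭ h)
  ↓ᵗ-↭ (Perm.trans h h′)                     = ↭-trans (↓ᵗ-↭ h) (↓ᵗ-↭ h′)

  at-↓ᵗ : ∀ t L → at (suc t) L ↓ᵗ ≡ at t L
  at-↓ᵗ t []      = refl
  at-↓ᵗ t (x ∷ L) = cong (_ ∷_) (at-↓ᵗ t L)

  Due : Triple → Set
  Due t = delay t ≡ 0

  due-↓ᵗ : ∀ L → All Due L → L ↓ᵗ ≡ []
  due-↓ᵗ []                    []           = refl
  due-↓ᵗ ((zero , s , q) ∷ L)  (refl ∷ ds) = due-↓ᵗ L ds

  at-zero-due : ∀ L → All Due (at 0 L)
  at-zero-due []      = []
  at-zero-due (x ∷ L) = refl ∷ at-zero-due L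

  at-suc-not-due : ∀ τ L {t} → t ∈ at (suc τ) L → ¬ Due t
  at-suc-not-due τ L m d with ∈-map⁻ _ m
  at-suc-not-due τ L m () | _ , _ , refl

  ↓-All-src : ∀ {Q : State → Set} Ψ → All (Q ∘ src) Ψ → All (Q ∘ src) (Ψ ↓)
  ↓-All-src []                    []       = []
  ↓-All-src (ev n zero a b ∷ Ψ)    (_ ∷ qs) = ↓-All-src Ψ qs
  ↓-All-src (ev n (suc k) a b ∷ Ψ) (q ∷ qs) = q ∷ ↓-All-src Ψ qs

  strip-∈ : ∀ {Ψ p Ψ′ L} → Ψ ↭ p ∷ Ψ′ → map strip Ψ ↭ L → strip p ∈ L
  strip-∈ h₁ h₂ = ∈-resp-↭ h₂ (∈-resp-↭ (↭-map⁺ strip (↭-sym h₁)) (here refl))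

  strip-remove : ∀ {Ψ p Ψ′ L t L′} → Ψ ↭ p ∷ Ψ′ → map strip Ψ ↭ L → L ↭ t ∷ L′ → strip p ≡ t →
                 map strip Ψ′ ↭ L′
  strip-remove h₁ h₂ h₃ refl = drop-∷ (↭-trans (↭-map⁺ strip (↭-sym h₁)) (↭-trans h₂ h₃))

  strip-pick : ∀ {Ψ t L} → map strip Ψ ↭ t ∷ L →
               Σ Event λ p → Σ (List Event) λ Ψ′ → (Ψ ↭ p ∷ Ψ′) × strip p ≡ t × map strip Ψ′ ↭ L
  strip-pick h with ∈-map⁻ strip (∈-resp-↭ (↭-sym h) (here refl))
  ... | p , p∈ , refl with ∈-∃++ p∈
  ... | Ψa , Ψb , refl = p , Ψa ++ Ψb , shift p Ψa Ψb , refl , strip-remove (shift p Ψa Ψb) h ↭-refl refl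

  All-remove : ∀ {Q : Event → Set} {Ψ p Ψ′} → Ψ ↭ p ∷ Ψ′ → All Q Ψ → All Q Ψ′
  All-remove h qs with All-resp-↭ h qs
  ... | _ ∷ qs′ = qs′

  strip-All : ∀ {Q : Triple → Set} {Ψ L} → map strip Ψ ↭ L → All Q L → All (Q ∘ strip) Ψ
  strip-All h qs = All.map⁻ (All-resp-↭ (↭-sym h) qs)

  Urgent : State → Triple → Set
  Urgent n t = Due t × origin t ≡ n

  nored-strip : ∀ {Ψ L n} → map strip Ψ ↭ L → (∀ {t} → t ∈ L → ¬ Urgent n t) → nored Ψ n
  nored-strip h calm = strip-All h (All.tabulate calm)

  nored-strip⁻ : ∀ {Ψ L n t} → nored Ψ n → map strip Ψ ↭ L → t ∈ L → ¬ Urgent n t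
  nored-strip⁻ nr h m = All.lookup (All-resp-↭ h (All.map⁺ nr)) m

open Triples

module Compilation where

  -- (k , s , q) ∈ spawns stands for  now + suc k ≫ @s ⇒ @q,  so compiled contracts are time-ahead.
  record FunSpec : Set where
    constructor fun
    field
      pre    : Loc
      spawns : List (ℕ × Edge)
      post   : Loc
  open FunSpec public

  compileEvents : ℕ → List (ℕ × Edge) → List Event
  compileEvents n []                  = []
  compileEvents n ((k , s , q) ∷ es) = ev n (suc k) (enc s) (enc q) ∷ compileEvents (suc n) es

  compileFuns : ℕ → List FunSpec → List Fun
  compileFuns n []       = []
  compileFuns n (g ∷ gs) =
    fn (enc (pre g)) (compileEvents n (spawns g)) (enc (post g)) ∷ compileFuns (n + length (spawns g)) gs

  compile : Loc → List FunSpec → Contract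
  compile q₀ gs = contract (enc q₀) (compileFuns 0 gs)

  linesFrom : ℕ → ℕ → List ℕ
  linesFrom n zero    = []
  linesFrom n (suc m) = n ∷ linesFrom (suc n) m

  linesFrom-++ : ∀ n a b → linesFrom n a ++ linesFrom (n + a) b ≡ linesFrom n (a + b)
  linesFrom-++ n zero    b = cong (λ x → linesFrom x b) (+-identityʳ n)
  linesFrom-++ n (suc a) b = cong (n ∷_) (begin
    linesFrom (suc n) a ++ linesFrom (n + suc a) b ≡⟨ cong (λ x → linesFrom (suc n) a ++ linesFrom x b) (+-suc n a) ⟩
    linesFrom (suc n) a ++ linesFrom (suc n + a) b ≡⟨ linesFrom-++ (suc n) a b ⟩
    linesFrom (suc n) (a + b)                      ∎)
    where open ≡-Reasoning

  linesFrom-≥ : ∀ n m → All (n ≤_) (linesFrom n m)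
  linesFrom-≥ n zero    = []
  linesFrom-≥ n (suc m) = ≤-refl ∷ All.map (≤-trans (n≤1+n n)) (linesFrom-≥ (suc n) m)

  linesFrom-unique : ∀ n m → Unique (linesFrom n m)
  linesFrom-unique n zero    = AllPairs.[]
  linesFrom-unique n (suc m) =
    All.map (λ n<x n≡x → <-irrefl n≡x n<x) (linesFrom-≥ (suc n) m) AllPairs.∷ linesFrom-unique (suc n) m

  eventCount : List FunSpec → ℕ
  eventCount []       = 0
  eventCount (g ∷ gs) = length (spawns g) + eventCount gs

  lines-compileEvents : ∀ n es → map line (compileEvents n es) ≡ linesFrom n (length es)
  lines-compileEvents n []                  = refl
  lines-compileEvents n ((k , s , q) ∷ es) = cong (n ∷_) (lines-compileEvents (suc n) es)

  lines-compileFuns : ∀ n gs → concatMap (λ f → map line (events f)) (compileFuns n gs) ≡ linesFrom n (eventCount gs)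
  lines-compileFuns n []       = refl
  lines-compileFuns n (g ∷ gs) =
    trans (cong₂ _++_ (lines-compileEvents n (spawns g)) (lines-compileFuns (n + length (spawns g)) gs))
          (linesFrom-++ n (length (spawns g)) (eventCount gs))

  compileEvents-delayed : ∀ n es → All (λ e → 0 < time e) (compileEvents n es)
  compileEvents-delayed n []                  = []
  compileEvents-delayed n ((k , s , q) ∷ es) = s≤s z≤n ∷ compileEvents-delayed (suc n) es

  compileFuns-delayed : ∀ n gs → All (λ f → All (λ e → 0 < time e) (events f)) (compileFuns n gs)
  compileFuns-delayed n []       = []
  compileFuns-delayed n (g ∷ gs) = compileEvents-delayed n (spawns g) ∷ compileFuns-delayed _ gs

  compile-IsTA : ∀ q₀ gs → IsTA (compile q₀ gs)
  compile-IsTA q₀ gs =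
    compileFuns-delayed 0 gs , subst Unique (sym (lines-compileFuns 0 gs)) (linesFrom-unique 0 _)

  scheduled : ℕ → List Edge → List (ℕ × Edge)
  scheduled k = map (k ,_)

  delayed : ℕ × Edge → Triple
  delayed (k , e) = pend (suc k) e

  delayed-scheduled : ∀ k L → map delayed (scheduled k L) ≡ at (suc k) L
  delayed-scheduled k []      = refl
  delayed-scheduled k (x ∷ L) = cong (_ ∷_) (delayed-scheduled k L)

  strip-compileEvents : ∀ n es → map strip (compileEvents n es) ≡ map delayed es
  strip-compileEvents n []                  = refl
  strip-compileEvents n ((k , s , q) ∷ es) = cong (_ ∷_) (strip-compileEvents (suc n) es)

  Implements : Fun → FunSpec → Set
  Implements f g = from f ≡ enc (pre g) × to f ≡ enc (post g) × map strip (events f) ≡ map delayed (spawns g)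

  compileFuns-∈⁻ : ∀ n gs {f} → f ∈ compileFuns n gs → ∃ λ g → g ∈ gs × Implements f g
  compileFuns-∈⁻ n (g ∷ gs) (here refl) = g , here refl , refl , refl , strip-compileEvents n (spawns g)
  compileFuns-∈⁻ n (g ∷ gs) (there f∈) with compileFuns-∈⁻ _ gs f∈
  ... | g′ , g′∈ , impl = g′ , there g′∈ , impl

  compileFuns-∈⁺ : ∀ n gs {g} → g ∈ gs → ∃ λ f → f ∈ compileFuns n gs × Implements f g
  compileFuns-∈⁺ n (g ∷ gs) (here refl) = _ , here refl , refl , refl , strip-compileEvents n (spawns g)
  compileFuns-∈⁺ n (g ∷ gs) (there g∈) with compileFuns-∈⁺ _ gs g∈
  ... | f , f∈ , impl = f , there f∈ , impl

open Compilation

module RoundEdges where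

  copyEdge compareEdge : Bool → Family → Edge
  copyEdge β φ    = round β copy , round β (copied φ)
  compareEdge β φ = round β (compare φ) , round β (compared φ)

  unit : Bool → Family → List Edge
  unit β φ = copyEdge β φ ∷ compareEdge β φ ∷ []

  units copyTokens compareTokens : Bool → Counts → List Edge
  units β c         = byFamily c (unit β)
  copyTokens β c    = byFamily c (λ φ → copyEdge β φ ∷ [])
  compareTokens β c = byFamily c (λ φ → compareEdge β φ ∷ [])

  units-split : ∀ β c → units β c ↭ copyTokens β c ++ compareTokens β c
  units-split β c = byFamily-++ c (λ φ → copyEdge β φ ∷ []) (λ φ → compareEdge β φ ∷ [])

  compareRemaining : Bool → Fin 2 → ℕ → ℕ → List Edge
  compareRemaining β r x y = copies x (compareEdge β (up r) ∷ []) ++ copies y (compareEdge β (down r) ∷ [])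

  compareOthers : Bool → Fin 2 → Counts → List Edge
  compareOthers β 0F c = copies (c (up 1F)) (compareEdge β (up 1F) ∷ []) ++ copies (c (down 1F)) (compareEdge β (down 1F) ∷ [])
  compareOthers β 1F c = copies (c (up 0F)) (compareEdge β (up 0F) ∷ []) ++ copies (c (down 0F)) (compareEdge β (down 0F) ∷ [])

  compareTokens-split : ∀ β r c → compareTokens β c ↭ compareRemaining β r (c (up r)) (c (down r)) ++ compareOthers β r c
  compareTokens-split β 0F c = ↭-reflexive (sym (++-assoc (copies (c (up 0F)) _) _ _))
  compareTokens-split β 1F c =
    ↭-trans (↭-reflexive (sym (++-assoc (copies (c (up 0F)) _) (copies (c (down 0F)) _) _)))
            (↭-++-comm (copies (c (up 0F)) _ ++ copies (c (down 0F)) _) _)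

  resume : Bool → Edge
  resume β = wait , round β copy

  zeroExit decExit : Bool → ℕ → Fin 2 → Edge
  zeroExit β pc r = round β (exhausted (up r)) , instr β onZero pc
  decExit β pc r  = round β (exhausted (down r)) , instr β onDec pc

  testExits : Bool → ℕ → Fin 2 → List Edge
  testExits β pc r = zeroExit β pc r ∷ decExit β pc r ∷ []

  performEdge : Bool → ℕ → Edge
  performEdge β pc = round β dispatch , instr β onInc pc

  testEdge : Bool → Fin 2 → Edge
  testEdge β r = round β dispatch , round β (compare (up r))

  dispatchEdges : Bool → ℕ → Maybe Instr → List Edge
  dispatchEdges β pc nothing            = []
  dispatchEdges β pc (just (inc r j))   = performEdge β pc ∷ []
  dispatchEdges β pc (just (dec r z j)) = testEdge β r ∷ testExits β pc r

  families : List Family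
  families = up 0F ∷ down 0F ∷ up 1F ∷ down 1F ∷ []

  family-∈ : ∀ φ → φ ∈ families
  family-∈ (up 0F)   = here refl
  family-∈ (down 0F) = there (here refl)
  family-∈ (up 1F)   = there (there (here refl))
  family-∈ (down 1F) = there (there (there (here refl)))

  stages : List Stage
  stages = copy ∷ dispatch ∷ map copied families ++ map compare families ++ map compared families ++ map exhausted families

  stage-∈ : ∀ g → g ∈ stages
  stage-∈ copy          = here refl
  stage-∈ dispatch      = there (here refl)
  stage-∈ (copied φ)    = there (there (∈-++⁺ˡ (∈-map⁺ copied (family-∈ φ))))
  stage-∈ (compare φ)   = there (there (∈-++⁺ʳ (map copied families) (∈-++⁺ˡ (∈-map⁺ compare (family-∈ φ)))))
  stage-∈ (compared φ)  = there (there (∈-++⁺ʳ (map copied families) (∈-++⁺ʳ (map compare families)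
                            (∈-++⁺ˡ (∈-map⁺ compared (family-∈ φ))))))
  stage-∈ (exhausted φ) = there (there (∈-++⁺ʳ (map copied families) (∈-++⁺ʳ (map compare families)
                            (∈-++⁺ʳ (map compared families) (∈-map⁺ exhausted (family-∈ φ))))))

  instrLocs : Bool → ℕ → List Loc
  instrLocs β zero    = []
  instrLocs β (suc n) = instr β onInc n ∷ instr β onZero n ∷ instr β onDec n ∷ instrLocs β n

  instr-∈ : ∀ β k {pc} n → pc < n → instr β k pc ∈ instrLocs β n
  instr-∈ β k {pc} (suc n) pc<1+n with m≤n⇒m<n∨m≡n (s≤s⁻¹ pc<1+n)
  instr-∈ β onInc  (suc n) _ | inj₂ refl = here refl
  instr-∈ β onZero (suc n) _ | inj₂ refl = there (here refl)
  instr-∈ β onDec  (suc n) _ | inj₂ refl = there (there (here refl))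
  ... | inj₁ pc<n = there (there (there (instr-∈ β k n pc<n)))

  roundLocs : Bool → ℕ → List Loc
  roundLocs β n = map (round β) stages ++ instrLocs β n

  data InRound (β : Bool) : Loc → Set where
    stage : ∀ g → InRound β (round β g)
    step  : ∀ k pc → InRound β (instr β k pc)

  roundLocs-InRound : ∀ β n → All (InRound β) (roundLocs β n)
  roundLocs-InRound β n = All.++⁺ (All.map⁺ (All.tabulate λ {g} _ → stage g)) (instrs n)
    where
    instrs : ∀ n → All (InRound β) (instrLocs β n)
    instrs zero    = []
    instrs (suc n) = step onInc n ∷ step onZero n ∷ step onDec n ∷ instrs n

open RoundEdges

NoSource : Loc → List Edge → Set
NoSource s = All (λ e → proj₁ e ≢ s)

RoundSourced : Bool → List Edge → Set
RoundSourced β = All (λ e → ∃ λ g → proj₁ e ≡ round β g)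

module EdgeSources where

  NoSource-∉ : ∀ {s L q} → NoSource s L → (s , q) ∈ L → ⊥
  NoSource-∉ ns sq∈ = All.lookup ns sq∈ refl

  copyTokens-noSource : ∀ {β s} c → round β copy ≢ s → NoSource s (copyTokens β c)
  copyTokens-noSource {β} c ne = byFamily-All c (λ φ → copyEdge β φ ∷ []) (λ φ → ne ∷ [])

  compareTokens-noSource : ∀ {β s} c → (∀ φ → round β (compare φ) ≢ s) → NoSource s (compareTokens β c)
  compareTokens-noSource {β} c ne = byFamily-All c (λ φ → compareEdge β φ ∷ []) (λ φ → ne φ ∷ [])

  compareRemaining-noSource : ∀ {β s} r x y → (∀ φ → round β (compare φ) ≢ s) → NoSource s (compareRemaining β r x y)
  compareRemaining-noSource r x y ne = All.++⁺ (copies-All x (ne _ ∷ [])) (copies-All y (ne _ ∷ []))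

  compareOthers-noSource : ∀ {β s} r c → (∀ φ → round β (compare φ) ≢ s) → NoSource s (compareOthers β r c)
  compareOthers-noSource 0F c ne = All.++⁺ (copies-All (c (up 1F)) (ne _ ∷ [])) (copies-All (c (down 1F)) (ne _ ∷ []))
  compareOthers-noSource 1F c ne = All.++⁺ (copies-All (c (up 0F)) (ne _ ∷ [])) (copies-All (c (down 0F)) (ne _ ∷ []))

  testExits-noSource : ∀ {β s} pc r → (∀ φ → round β (exhausted φ) ≢ s) → NoSource s (testExits β pc r)
  testExits-noSource pc r ne = ne _ ∷ ne _ ∷ []

  dispatchEdges-noSource : ∀ {β s} pc m → round β dispatch ≢ s → (∀ φ → round β (exhausted φ) ≢ s) →
                           NoSource s (dispatchEdges β pc m)
  dispatchEdges-noSource pc nothing            ne ne′ = []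
  dispatchEdges-noSource pc (just (inc r j))   ne ne′ = ne ∷ []
  dispatchEdges-noSource pc (just (dec r z j)) ne ne′ = ne ∷ testExits-noSource pc r ne′

  compareTokens-sourced : ∀ β c → RoundSourced β (compareTokens β c)
  compareTokens-sourced β c = byFamily-All c (λ φ → compareEdge β φ ∷ []) (λ φ → (_ , refl) ∷ [])

  compareRemaining-sourced : ∀ β r x y → RoundSourced β (compareRemaining β r x y)
  compareRemaining-sourced β r x y = All.++⁺ (copies-All x ((_ , refl) ∷ [])) (copies-All y ((_ , refl) ∷ []))

  compareOthers-sourced : ∀ β r c → RoundSourced β (compareOthers β r c)
  compareOthers-sourced β 0F c = All.++⁺ (copies-All (c (up 1F)) ((_ , refl) ∷ [])) (copies-All (c (down 1F)) ((_ , refl) ∷ []))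
  compareOthers-sourced β 1F c = All.++⁺ (copies-All (c (up 0F)) ((_ , refl) ∷ [])) (copies-All (c (down 0F)) ((_ , refl) ∷ []))

  RoundSourced-noSource : ∀ {β s L} → RoundSourced β L → (∀ g → round β g ≢ s) → NoSource s L
  RoundSourced-noSource rs ne = All.map (λ { (g , refl) → ne g }) rs

open EdgeSources

module Simulation (P : Program) where

  N : ℕ
  N = length P

  -- Scheduled two steps ahead, so they become due only if round β is left by a premature tick.
  guards : Bool → List Edge
  guards β = map (_, dead) (roundLocs β N)

  scheduleNext : Bool → ℕ → List (ℕ × Edge)
  scheduleNext β j = scheduled 0 (resume β ∷ dispatchEdges β j (instrAt P j)) ++ scheduled 1 (guards β)

  afterJump : Maybe Instr → Loc
  afterJump nothing  = halt
  afterJump (just _) = wait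

  jump : Bool → ℕ → List (ℕ × Edge) → Loc → FunSpec
  jump β j W s = fun s (W ++ scheduleNext (not β) j) (afterJump (instrAt P j))

  instrSpecs : Bool → Branch → ℕ → Maybe Instr → List FunSpec
  instrSpecs β onInc  pc (just (inc r j))   = jump β j (scheduled 0 (unit (not β) (up r))) (instr β onInc pc) ∷ []
  instrSpecs β onZero pc (just (dec r z j)) = jump β z [] (instr β onZero pc) ∷ []
  instrSpecs β onDec  pc (just (dec r z j)) = jump β j (scheduled 0 (unit (not β) (down r))) (instr β onDec pc) ∷ []
  instrSpecs β _      pc _                  = []

  specsAt : Loc → List FunSpec
  specsAt boot                   = jump true 0 [] boot ∷ []
  specsAt (round β copy)         = fun (round β copy) [] (round β dispatch) ∷ []
  specsAt (round β (copied φ))   = fun (round β (copied φ)) (scheduled 0 (unit (not β) φ)) (round β copy) ∷ []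
  specsAt (round β (compare φ))  = fun (round β (compare φ)) [] (round β (exhausted φ)) ∷ []
  specsAt (round β (compared φ)) = fun (round β (compared φ)) [] (round β (compare (flip φ))) ∷ []
  specsAt (instr β k pc)         = instrSpecs β k pc (instrAt P pc)
  specsAt _                      = []

  sources : List Loc
  sources = boot ∷ roundLocs false N ++ roundLocs true N

  simulator : Contract
  simulator = compile boot (concatMap specsAt sources)

  pre-instrSpecs : ∀ β k pc m {g} → g ∈ instrSpecs β k pc m → pre g ≡ instr β k pc
  pre-instrSpecs β onInc  pc (just (inc r j))   (here refl) = refl
  pre-instrSpecs β onZero pc (just (dec r z j)) (here refl) = refl
  pre-instrSpecs β onDec  pc (just (dec r z j)) (here refl) = refl

  pre-specsAt : ∀ s {g} → g ∈ specsAt s → pre g ≡ s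
  pre-specsAt boot                   (here refl) = refl
  pre-specsAt (round β copy)         (here refl) = refl
  pre-specsAt (round β (copied φ))   (here refl) = refl
  pre-specsAt (round β (compare φ))  (here refl) = refl
  pre-specsAt (round β (compared φ)) (here refl) = refl
  pre-specsAt (instr β k pc)         g∈          = pre-instrSpecs β k pc (instrAt P pc) g∈

  spec-of : ∀ {f s} → f ∈ functions simulator → from f ≡ enc s → ∃ λ g → g ∈ specsAt s × Implements f g
  spec-of {f} {s} f∈ from≡ with compileFuns-∈⁻ 0 (concatMap specsAt sources) f∈
  ... | g , g∈ , impl@(pre≡ , _) with Any.satisfied (∈-concatMap⁻ specsAt {xs = sources} g∈)
  ... | s′ , g∈′ with pre-specsAt s′ g∈′
  ... | refl with enc-injective {pre g} {s} (trans (sym pre≡) from≡)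
  ... | refl = g , g∈′ , impl

  function-of : ∀ {s g} → s ∈ sources → g ∈ specsAt s → ∃ λ f → f ∈ functions simulator × Implements f g
  function-of s∈ g∈ = compileFuns-∈⁺ 0 _ (∈-concatMap⁺ specsAt (Any.map (λ { refl → g∈ }) s∈))

  roundLoc-source : ∀ {β s} → s ∈ roundLocs β N → s ∈ sources
  roundLoc-source {false} s∈ = there (∈-++⁺ˡ s∈)
  roundLoc-source {true}  s∈ = there (∈-++⁺ʳ (roundLocs false N) s∈)

  round-source : ∀ β g → round β g ∈ sources
  round-source β g = roundLoc-source {β} (∈-++⁺ˡ (∈-map⁺ (round β) (stage-∈ g)))

  InRound-unique : ∀ {β γ s} → InRound β s → InRound γ s → β ≡ γ
  InRound-unique (stage g)   (stage .g)    = refl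
  InRound-unique (step k pc) (step .k .pc) = refl

  Local : Bool → Loc → Set
  Local β s = ∀ {γ} → InRound γ s → γ ≡ β

  Foreign : Bool → State → Set
  Foreign β n = ∃ λ s → n ≡ enc s × ∃ λ γ → InRound γ s × γ ≢ β

  -- Due events at locations of the other round: the next tick deletes them before they can fire.
  Junk : Bool → List Triple → Set
  Junk β = All (λ t → Due t × Foreign β (origin t))

  StaleTriple : Bool → Triple → Set
  StaleTriple β t = (Due t × origin t ≢ enc wait) ⊎ (delay t ≡ 1 × Foreign β (origin t))

  Stale : Bool → List Triple → Set
  Stale β = All (StaleTriple β)

  Stale-↓ᵗ : ∀ {β} R → Stale β R → Junk β (R ↓ᵗ)
  Stale-↓ᵗ []                       []                   = []
  Stale-↓ᵗ ((zero , _) ∷ R)        (_ ∷ st)             = Stale-↓ᵗ R st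
  Stale-↓ᵗ ((suc zero , _) ∷ R)    (inj₂ (_ , fo) ∷ st) = (refl , fo) ∷ Stale-↓ᵗ R st
  Stale-↓ᵗ ((suc k , _) ∷ R)       (inj₁ (() , _) ∷ st)
  Stale-↓ᵗ ((suc (suc k) , _) ∷ R) (inj₂ (() , _) ∷ st)

  Junk-↓ᵗ : ∀ {β} J → Junk β J → J ↓ᵗ ≡ []
  Junk-↓ᵗ J junk = due-↓ᵗ J (All.map proj₁ junk)

  Junk-calm : ∀ {β s J t} → Local β s → Junk β J → t ∈ J → ¬ Urgent (enc s) t
  Junk-calm {s = s} loc junk t∈ (_ , o≡s) with All.lookup junk t∈
  ... | _ , s′ , o≡s′ , γ , inR , γ≢β with enc-injective {s} {s′} (trans (sym o≡s) o≡s′)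
  ... | refl = γ≢β (loc inR)

  armed : Bool → List Triple → List Triple
  armed β J = at 1 (guards β) ++ J

  armed-calm : ∀ {β s J t} → Local β s → Junk β J → t ∈ armed β J → ¬ Urgent (enc s) t
  armed-calm {β} loc junk t∈ u with ∈-++⁻ (at 1 (guards β)) t∈
  ... | inj₁ t∈g = at-suc-not-due 0 (guards β) t∈g (proj₁ u)
  ... | inj₂ t∈J = Junk-calm loc junk t∈J u

  at-urgent : ∀ {t τ L s} → t ∈ at τ L → Urgent (enc s) t → ∃ λ q → (s , q) ∈ L × t ≡ pend 0 (s , q)
  at-urgent {s = s} t∈ (refl , o≡s) with ∈-map⁻ _ t∈
  ... | (a , b) , ab∈ , refl with enc-injective {a} {s} o≡s
  ... | refl = b , ab∈ , refl

  -- Pending events inside round β, where d counts the units already respawned for the next round.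
  midRound : Bool → Counts → List Edge → List Triple → List Triple
  midRound β d L J = at 1 (units (not β) d) ++ (at 0 L ++ armed β J)

  midRound-urgent : ∀ {β s d L J t} → Local β s → Junk β J → t ∈ midRound β d L J → Urgent (enc s) t →
                    ∃ λ q → (s , q) ∈ L × t ≡ pend 0 (s , q)
  midRound-urgent {β} {d = d} {L} loc junk t∈ u with ∈-++⁻ (at 1 (units (not β) d)) t∈
  ... | inj₁ t∈u = ⊥-elim (at-suc-not-due 0 (units (not β) d) t∈u (proj₁ u))
  ... | inj₂ t∈′ with ∈-++⁻ (at 0 L) t∈′
  ... | inj₁ t∈L = at-urgent t∈L u
  ... | inj₂ t∈a = ⊥-elim (armed-calm loc junk t∈a u)

  midRound-calm : ∀ {β s d L J t} → Local β s → Junk β J → NoSource s L → t ∈ midRound β d L J → ¬ Urgent (enc s) t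
  midRound-calm {d = d} {L} loc junk ns t∈ u with midRound-urgent {d = d} {L} loc junk t∈ u
  ... | q , sq∈ , _ = NoSource-∉ ns sq∈

  roundStart : Bool → ℕ → Instr → List Edge
  roundStart β pc ins = resume β ∷ dispatchEdges β pc (just ins)

  atBoundary : Bool → ℕ → Instr → Counts → List Triple
  atBoundary β pc ins c = at 1 (units β c) ++ (at 1 (roundStart β pc ins) ++ at 2 (guards β))

  afterTick : Bool → ℕ → Instr → Counts → List Triple → List Triple
  afterTick β pc ins c J = at 0 (units β c) ++ (at 0 (roundStart β pc ins) ++ armed β J)

  boundary-↓ᵗ : ∀ β pc ins c R → (atBoundary β pc ins c ++ R) ↓ᵗ ≡ afterTick β pc ins c (R ↓ᵗ)
  boundary-↓ᵗ β pc ins c R = begin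
    (atBoundary β pc ins c ++ R) ↓ᵗ
      ≡⟨ ↓ᵗ-++ (atBoundary β pc ins c) R ⟩
    (U₁ ++ (S₁ ++ G₂)) ↓ᵗ ++ R ↓ᵗ
      ≡⟨ cong (_++ R ↓ᵗ) (trans (↓ᵗ-++ U₁ _) (cong (U₁ ↓ᵗ ++_) (↓ᵗ-++ S₁ G₂))) ⟩
    (U₁ ↓ᵗ ++ (S₁ ↓ᵗ ++ G₂ ↓ᵗ)) ++ R ↓ᵗ
      ≡⟨ cong (_++ R ↓ᵗ) (cong₂ _++_ (at-↓ᵗ 0 (units β c))
                                     (cong₂ _++_ (at-↓ᵗ 0 (roundStart β pc ins)) (at-↓ᵗ 1 (guards β)))) ⟩
    (U₀ ++ (S₀ ++ G₁)) ++ R ↓ᵗ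
      ≡⟨ trans (++-assoc U₀ _ _) (cong (U₀ ++_) (++-assoc S₀ G₁ _)) ⟩
    afterTick β pc ins c (R ↓ᵗ) ∎
    where
    open ≡-Reasoning
    U₁ S₁ G₂ U₀ S₀ G₁ : List Triple
    U₁ = at 1 (units β c)
    S₁ = at 1 (roundStart β pc ins)
    G₂ = at 2 (guards β)
    U₀ = at 0 (units β c)
    S₀ = at 0 (roundStart β pc ins)
    G₁ = at 1 (guards β)

  dispatchDue : Bool → ℕ → Instr → Counts → List Edge
  dispatchDue β pc ins c = dispatchEdges β pc (just ins) ++ compareTokens β c

  copyDue : Bool → ℕ → Instr → Counts → Counts → List Edge
  copyDue β pc ins c rest = copyTokens β rest ++ dispatchDue β pc ins c

  compareRest : Bool → Fin 2 → Counts → ℕ → ℕ → List Edge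
  compareRest β r c x y = compareRemaining β r x y ++ compareOthers β r c

  compareDue : Bool → ℕ → Fin 2 → Counts → ℕ → ℕ → List Edge
  compareDue β pc r c x y = testExits β pc r ++ compareRest β r c x y

  start : MConfig
  start = 0 , 0 ∷ 0 ∷ []

  Reaches : ℕ → Counts → Set
  Reaches pc c = Star (MStep P) start (pc , registers c)

  Simulated : ℕ → Counts → Instr → Set
  Simulated pc c ins = instrAt P pc ≡ just ins × Reaches pc c × Balanced c

  data CompareStage : Set where
    onUp afterUp onDown afterDown doneUp doneDown : CompareStage

  compareAt : CompareStage → Fin 2 → Stage
  compareAt onUp      r = compare (up r)
  compareAt afterUp   r = compared (up r)
  compareAt onDown    r = compare (down r)
  compareAt afterDown r = compared (down r)
  compareAt doneUp    r = exhausted (up r)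
  compareAt doneDown  r = exhausted (down r)

  -- x and y count the pending up and down compare events of the register, whose unit counts are a and b.
  CompareInv : CompareStage → ℕ → ℕ → ℕ → ℕ → Set
  CompareInv onUp      x y a b = y ≤ x × x + b ≡ y + a
  CompareInv afterDown x y a b = y ≤ x × x + b ≡ y + a
  CompareInv afterUp   x y a b = y ≤ suc x × suc x + b ≡ y + a
  CompareInv onDown    x y a b = y ≤ suc x × suc x + b ≡ y + a
  CompareInv doneUp    x y a b = x ≡ 0 × y ≤ x × x + b ≡ y + a
  CompareInv doneDown  x y a b = y ≡ 0 × suc x + b ≡ y + a

  record Doomed (n : State) (Ψ : List Event) : Set where
    field
      not-halt    : n ≢ enc halt
      urgent      : ∃ λ e → e ∈ Ψ × time e ≡ 0 × src e ≡ n
      to-dead     : All (λ e → time e ≡ 0 → src e ≡ n → tgt e ≡ enc dead) Ψ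
      dead-silent : All (λ e → src e ≢ enc dead) Ψ

  data Phase : State → List Event → Set where
    booting     : Phase (enc boot) []
    boundary    : ∀ {Ψ} β pc c ins R → Simulated pc c ins → map strip Ψ ↭ atBoundary β pc ins c ++ R → Stale β R →
                  Phase (enc wait) Ψ
    started     : ∀ {Ψ} β pc c ins J → Simulated pc c ins → map strip Ψ ↭ afterTick β pc ins c J → Junk β J →
                  Phase (enc wait) Ψ
    copying     : ∀ {Ψ} β pc c ins J rest done → Simulated pc c ins → Split rest done c →
                  map strip Ψ ↭ midRound β done (copyDue β pc ins c rest) J → Junk β J →
                  Phase (enc (round β copy)) Ψ
    respawning  : ∀ {Ψ} β pc c ins J rest done φ → Simulated pc c ins → Split rest (done [ φ ≔ suc (done φ) ]) c →
                  map strip Ψ ↭ midRound β done (copyDue β pc ins c rest) J → Junk β J →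
                  Phase (enc (round β (copied φ))) Ψ
    dispatching : ∀ {Ψ} β pc c ins J → Simulated pc c ins → map strip Ψ ↭ midRound β c (dispatchDue β pc ins c) J →
                  Junk β J → Phase (enc (round β dispatch)) Ψ
    comparing   : ∀ {Ψ} β pc c r z j J x y a → Simulated pc c (dec r z j) → CompareInv a x y (c (up r)) (c (down r)) →
                  map strip Ψ ↭ midRound β c (compareDue β pc r c x y) J → Junk β J →
                  Phase (enc (round β (compareAt a r))) Ψ
    finishing   : ∀ {Ψ} β k pc j c c′ W L J → pc < N → specsAt (instr β k pc) ≡ jump β j W (instr β k pc) ∷ [] →
                  map delayed W ++ at 1 (units (not β) c) ↭ at 1 (units (not β) c′) → Reaches j c′ → Balanced c′ →
                  RoundSourced β L → map strip Ψ ↭ midRound β c L J → Junk β J →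
                  Phase (enc (instr β k pc)) Ψ
    doomed      : ∀ {n Ψ} → Doomed n Ψ → Phase n Ψ
    buried      : ∀ {Ψ} → All (λ e → src e ≢ enc dead) Ψ → Phase (enc dead) Ψ

  Outcome : State → List Event → Set
  Outcome n Ψ = Halts P ⊎ Phase n Ψ

  Inv : Config → Set
  Inv ⟨ n , nothing , Ψ ⟩        = Outcome n Ψ
  Inv ⟨ n , just (Ψw , q) , Ψ ⟩ = Outcome q (Ψw ++ Ψ)

  _⟶ₛ_ : Config → Config → Set
  _⟶ₛ_ = _⟶_ simulator

  Run : Config → Config → Set
  Run = Star _⟶ₛ_

  OnCall : Loc → List Event → Set
  OnCall s Ψ = ∀ {g} → g ∈ specsAt s → ∀ Ψ′ → map strip Ψ′ ≡ map delayed (spawns g) ++ map strip Ψ →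
               Outcome (enc (post g)) Ψ′

  call-outcome : ∀ {s f Ψ} → f ∈ functions simulator → from f ≡ enc s → OnCall s Ψ → Outcome (to f) (events f ++ Ψ)
  call-outcome {s} {f} {Ψ} f∈ from≡ k with spec-of {f} {s} f∈ from≡
  ... | g , g∈ , _ , to≡ , spawns≡ = subst (λ n → Outcome n (events f ++ Ψ)) (sym to≡)
          (k g∈ (events f ++ Ψ) (trans (map-++ strip (events f) Ψ) (cong (_++ map strip Ψ) spawns≡)))

  midRound-reorder : ∀ β d {L L′} J → L ↭ L′ → midRound β d L J ↭ midRound β d L′ J
  midRound-reorder β d J p = ++⁺ˡ (at 1 (units (not β) d)) (++⁺ʳ (armed β J) (↭-map⁺ (pend 0) p))

  midRound-pick : ∀ β d {L e} L′ J → L ↭ e ∷ L′ → midRound β d L J ↭ pend 0 e ∷ midRound β d L′ J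
  midRound-pick β d L′ J p =
    ↭-trans (midRound-reorder β d J p) (bring-front (at 1 (units (not β) d)) ↭-refl)

  midRound-take : ∀ β d X e Y J → midRound β d (X ++ e ∷ Y) J ↭ pend 0 e ∷ midRound β d (X ++ Y) J
  midRound-take β d X e Y J = midRound-pick β d (X ++ Y) J (shift e X Y)

  copy-take : ∀ β pc ins c done rest φ k J → rest φ ≡ suc k →
              midRound β done (copyDue β pc ins c rest) J ↭
              pend 0 (copyEdge β φ) ∷ midRound β done (copyDue β pc ins c (rest [ φ ≔ k ])) J
  copy-take β pc ins c done rest φ k J e =
    midRound-pick β done (copyDue β pc ins c (rest [ φ ≔ k ])) J
      (++⁺ʳ (dispatchDue β pc ins c) (byFamily-take rest (λ ψ → copyEdge β ψ ∷ []) φ k e))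

  units-put : ∀ β c φ → at 1 (unit β φ) ++ at 1 (units β c) ↭ at 1 (units β (c [ φ ≔ suc (c φ) ]))
  units-put β c φ = ↭-trans (↭-reflexive (sym (map-++ (pend 1) (unit β φ) (units β c))))
                            (↭-map⁺ (pend 1) (byFamily-put c (unit β) φ))

  respawn : ∀ β d φ L J → map delayed (scheduled 0 (unit (not β) φ)) ++ midRound β d L J ↭
                          midRound β (d [ φ ≔ suc (d φ) ]) L J
  respawn β d φ L J = begin
    map delayed (scheduled 0 (unit (not β) φ)) ++ midRound β d L J
      ≡⟨ cong (_++ midRound β d L J) (delayed-scheduled 0 (unit (not β) φ)) ⟩
    at 1 (unit (not β) φ) ++ (at 1 (units (not β) d) ++ rest)
      ≡⟨ sym (++-assoc (at 1 (unit (not β) φ)) (at 1 (units (not β) d)) rest) ⟩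
    (at 1 (unit (not β) φ) ++ at 1 (units (not β) d)) ++ rest
      ↭⟨ ++⁺ʳ rest (units-put (not β) d φ) ⟩
    midRound β (d [ φ ≔ suc (d φ) ]) L J ∎
    where
    open Perm.PermutationReasoning
    rest : List Triple
    rest = at 0 L ++ armed β J

  copying-exit : ∀ β pc ins c done rest J → Split rest done c → (∀ φ → rest φ ≡ 0) →
                 midRound β done (copyDue β pc ins c rest) J ≡ midRound β c (dispatchDue β pc ins c) J
  copying-exit β pc ins c done rest J split empty =
    cong₂ (λ U T → at 1 U ++ (at 0 (T ++ dispatchDue β pc ins c) ++ armed β J))
          (byFamily-cong (unit (not β)) (λ φ → trans (sym (cong (_+ done φ) (empty φ))) (split φ)))
          (byFamily-empty (λ φ → copyEdge β φ ∷ []) empty)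

  delayed-scheduleNext : ∀ β j {ins} → instrAt P j ≡ just ins →
                         map delayed (scheduleNext β j) ≡ at 1 (roundStart β j ins) ++ at 2 (guards β)
  delayed-scheduleNext β j {ins} eq = begin
    map delayed (scheduleNext β j)
      ≡⟨ map-++ delayed (scheduled 0 S) (scheduled 1 (guards β)) ⟩
    map delayed (scheduled 0 S) ++ map delayed (scheduled 1 (guards β))
      ≡⟨ cong₂ _++_ (delayed-scheduled 0 S) (delayed-scheduled 1 (guards β)) ⟩
    at 1 S ++ at 2 (guards β)
      ≡⟨ cong (λ m → at 1 (resume β ∷ dispatchEdges β j m) ++ at 2 (guards β)) eq ⟩
    at 1 (roundStart β j ins) ++ at 2 (guards β) ∎
    where
    open ≡-Reasoning
    S : List Edge
    S = resume β ∷ dispatchEdges β j (instrAt P j)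

  data Resumes (β : Bool) (j : ℕ) (c : Counts) (Ψ : List Event) : Set where
    halted  : instrAt P j ≡ nothing → Resumes β j c Ψ
    waiting : ∀ ins R → instrAt P j ≡ just ins → map strip Ψ ↭ atBoundary β j ins c ++ R → Stale β R → Resumes β j c Ψ

  jump-resumes : ∀ β j c R Ψ → Stale (not β) R →
                 map strip Ψ ↭ at 1 (units (not β) c) ++ (map delayed (scheduleNext (not β) j) ++ R) →
                 Resumes (not β) j c Ψ
  jump-resumes β j c R Ψ stale h = resumes (instrAt P j) refl
    where
    resumes : ∀ m → instrAt P j ≡ m → Resumes (not β) j c Ψ
    resumes nothing    eq = halted eq
    resumes (just ins) eq = waiting ins R eq (↭-trans h (↭-reflexive (begin
      U ++ (map delayed (scheduleNext (not β) j) ++ R) ≡⟨ cong (λ X → U ++ (X ++ R)) (delayed-scheduleNext (not β) j eq) ⟩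
      U ++ (atStart ++ R)                              ≡⟨ sym (++-assoc U atStart R) ⟩
      atBoundary (not β) j ins c ++ R                  ∎))) stale
      where
      open ≡-Reasoning
      U atStart : List Triple
      U = at 1 (units (not β) c)
      atStart = at 1 (roundStart (not β) j ins) ++ at 2 (guards (not β))

  Resumes-outcome : ∀ {β j c Ψ} → Reaches j c → Balanced c → Resumes β j c Ψ → Outcome (enc (afterJump (instrAt P j))) Ψ
  Resumes-outcome {j = j} {c} {Ψ} reaches bal (halted eq) =
    subst (λ m → Outcome (enc (afterJump m)) Ψ) (sym eq) (inj₁ ((j , registers c) , reaches , eq))
  Resumes-outcome {β} {j} {c} {Ψ} reaches bal (waiting ins R eq h stale) =
    subst (λ m → Outcome (enc (afterJump m)) Ψ) (sym eq) (inj₂ (boundary β j c ins R (eq , reaches , bal) h stale))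

  units-InRound : ∀ β c → All (InRound β ∘ proj₁) (units β c)
  units-InRound β c = byFamily-All c (unit β) (λ φ → stage copy ∷ stage (compare φ) ∷ [])

  guards-InRound : ∀ β → All (InRound β ∘ proj₁) (guards β)
  guards-InRound β = All.map⁺ (roundLocs-InRound β N)

  midRound-↓ᵗ : ∀ β d L J → Junk β J → midRound β d L J ↓ᵗ ≡ at 0 (units (not β) d) ++ at 0 (guards β)
  midRound-↓ᵗ β d L J junk = begin
    (U ++ (at 0 L ++ (G ++ J))) ↓ᵗ
      ≡⟨ trans (↓ᵗ-++ U _) (cong (U ↓ᵗ ++_) (trans (↓ᵗ-++ (at 0 L) _) (cong (at 0 L ↓ᵗ ++_) (↓ᵗ-++ G J)))) ⟩
    U ↓ᵗ ++ (at 0 L ↓ᵗ ++ (G ↓ᵗ ++ J ↓ᵗ))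
      ≡⟨ cong (λ X → U ↓ᵗ ++ (X ++ (G ↓ᵗ ++ J ↓ᵗ))) (due-↓ᵗ (at 0 L) (at-zero-due L)) ⟩
    U ↓ᵗ ++ (G ↓ᵗ ++ J ↓ᵗ)
      ≡⟨ cong₂ (λ X Y → U ↓ᵗ ++ (X ++ Y)) (at-↓ᵗ 0 (guards β)) (Junk-↓ᵗ J junk) ⟩
    U ↓ᵗ ++ (at 0 (guards β) ++ [])
      ≡⟨ cong₂ _++_ (at-↓ᵗ 0 (units (not β) d)) (++-identityʳ _) ⟩
    at 0 (units (not β) d) ++ at 0 (guards β) ∎
    where
    open ≡-Reasoning
    U G : List Triple
    U = at 1 (units (not β) d)
    G = at 1 (guards β)

  InRound-not-halt : ∀ {β s} → InRound β s → s ≢ halt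
  InRound-not-halt (stage g) ()
  InRound-not-halt (step k pc) ()

  InRound-not-dead : ∀ {β s} → InRound β s → s ≢ dead
  InRound-not-dead (stage g) ()
  InRound-not-dead (step k pc) ()

  -- A tick in the middle of a round arms the guard of the current location.
  tick-dooms : ∀ {Ψ β s} d L J → InRound β s → s ∈ roundLocs β N → Junk β J → map strip Ψ ↭ midRound β d L J →
               Doomed (enc s) (Ψ ↓)
  tick-dooms {Ψ} {β} {s} d L J inR s∈ junk h = record
    { not-halt    = λ e → InRound-not-halt inR (enc-injective {s} {halt} e)
    ; urgent      = guard-event
    ; to-dead     = strip-All h′ (All.++⁺ (All.map⁺ (All.map (λ {e} → units-foreign {e}) (units-InRound (not β) d)))
                                         (All.map⁺ (All.map⁺ {xs = roundLocs β N} (All.tabulate λ _ _ _ → refl))))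
    ; dead-silent = strip-All h′ (All.++⁺ (All.map⁺ (All.map (λ {e} → alive {e = e}) (units-InRound (not β) d)))
                                         (All.map⁺ (All.map (λ {e} → alive {e = e}) (guards-InRound β))))
    }
    where
    h′ : map strip (Ψ ↓) ↭ at 0 (units (not β) d) ++ at 0 (guards β)
    h′ = ↭-trans (↭-reflexive (strip-↓ Ψ)) (↭-trans (↓ᵗ-↭ h) (↭-reflexive (midRound-↓ᵗ β d L J junk)))
    guard-event : ∃ λ e → e ∈ Ψ ↓ × time e ≡ 0 × src e ≡ enc s
    guard-event with ∈-map⁻ strip (∈-resp-↭ (↭-sym h′)
                       (∈-++⁺ʳ (at 0 (units (not β) d)) (∈-map⁺ (pend 0) (∈-map⁺ (_, dead) s∈))))
    ... | e , e∈ , strip≡ = e , e∈ , sym (cong delay strip≡) , sym (cong origin strip≡)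
    units-foreign : ∀ {e : Edge} → InRound (not β) (proj₁ e) →
                    delay (pend 0 e) ≡ 0 → origin (pend 0 e) ≡ enc s → goal (pend 0 e) ≡ enc dead
    units-foreign {a , b} inR′ _ a≡s with enc-injective {a} {s} a≡s
    ... | refl = ⊥-elim (not-¬ refl (InRound-unique inR inR′))
    alive : ∀ {γ} {e : Edge} → InRound γ (proj₁ e) → origin (pend 0 e) ≢ enc dead
    alive {e = a , b} inR′ a≡dead = InRound-not-dead inR′ (enc-injective {a} {dead} a≡dead)

  local : ∀ {β s} → InRound β s → Local β s
  local inR inR′ = InRound-unique inR′ inR

  round-∈ : ∀ β g → round β g ∈ roundLocs β N
  round-∈ β g = ∈-++⁺ˡ (∈-map⁺ (round β) (stage-∈ g))

  instr-round-∈ : ∀ β k {pc} → pc < N → instr β k pc ∈ roundLocs β N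
  instr-round-∈ β k pc<N = ∈-++⁺ʳ (map (round β) stages) (instr-∈ β k N pc<N)

  instrAt-< : ∀ (Q : Program) pc {i} → instrAt Q pc ≡ just i → pc < length Q
  instrAt-< (_ ∷ Q) zero     _ = s≤s z≤n
  instrAt-< (_ ∷ Q) (suc pc) e = s≤s (instrAt-< Q pc e)

  units-put-scheduled : ∀ β c φ →
                        map delayed (scheduled 0 (unit β φ)) ++ at 1 (units β c) ↭ at 1 (units β (c [ φ ≔ suc (c φ) ]))
  units-put-scheduled β c φ =
    ↭-trans (↭-reflexive (cong (_++ at 1 (units β c)) (delayed-scheduled 0 (unit β φ)))) (units-put β c φ)

  boundary-calm : ∀ {β pc ins c R t} → Stale β R → t ∈ atBoundary β pc ins c ++ R → ¬ Urgent (enc wait) t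
  boundary-calm {β} {pc} {ins} {c} stale t∈ (t0 , o≡) with ∈-++⁻ (atBoundary β pc ins c) t∈
  ... | inj₁ t∈b with ∈-++⁻ (at 1 (units β c)) t∈b
  ... | inj₁ t∈u = at-suc-not-due 0 (units β c) t∈u t0
  ... | inj₂ t∈s with ∈-++⁻ (at 1 (roundStart β pc ins)) t∈s
  ... | inj₁ t∈r = at-suc-not-due 0 (roundStart β pc ins) t∈r t0
  ... | inj₂ t∈g = at-suc-not-due 1 (guards β) t∈g t0
  boundary-calm stale t∈ (t0 , o≡) | inj₂ t∈R with All.lookup stale t∈R
  ... | inj₁ (_ , o≢) = o≢ o≡
  ... | inj₂ (d≡1 , _) = 0≢1+n (trans (sym t0) d≡1)

  boundary-tick : ∀ {Ψ} β pc ins c R → map strip Ψ ↭ atBoundary β pc ins c ++ R →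
                  map strip (Ψ ↓) ↭ afterTick β pc ins c (R ↓ᵗ)
  boundary-tick {Ψ} β pc ins c R h =
    ↭-trans (↭-reflexive (strip-↓ Ψ)) (↭-trans (↓ᵗ-↭ h) (↭-reflexive (boundary-↓ᵗ β pc ins c R)))

  started-take : ∀ β pc ins c J →
                 afterTick β pc ins c J ↭ pend 0 (resume β) ∷ midRound β (λ _ → 0) (copyDue β pc ins c c) J
  started-take β pc ins c J = begin
    U ++ (pend 0 (resume β) ∷ D ++ A)
      ↭⟨ bring-front U ↭-refl ⟩
    pend 0 (resume β) ∷ (U ++ (D ++ A))
      ≡⟨ cong (pend 0 (resume β) ∷_) (trans (sym (++-assoc U D A)) (cong (_++ A) (sym (map-++ (pend 0) (units β c) _)))) ⟩
    pend 0 (resume β) ∷ (at 0 (units β c ++ dispatchEdges β pc (just ins)) ++ A)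
      ↭⟨ ↭-prep _ (++⁺ʳ A (↭-map⁺ (pend 0) reorder)) ⟩
    pend 0 (resume β) ∷ midRound β (λ _ → 0) (copyDue β pc ins c c) J ∎
    where
    open Perm.PermutationReasoning
    U D A : List Triple
    U = at 0 (units β c)
    D = at 0 (dispatchEdges β pc (just ins))
    A = armed β J
    reorder : units β c ++ dispatchEdges β pc (just ins) ↭ copyDue β pc ins c c
    reorder = ↭-trans (++⁺ʳ _ (units-split β c))
              (↭-trans (↭-reflexive (++-assoc (copyTokens β c) _ _))
                       (++⁺ˡ (copyTokens β c) (↭-++-comm (compareTokens β c) _)))

  copyDue-noSource : ∀ {β s} pc ins c rest → round β copy ≢ s → round β dispatch ≢ s →
                     (∀ φ → round β (exhausted φ) ≢ s) → (∀ φ → round β (compare φ) ≢ s) → NoSource s (copyDue β pc ins c rest)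
  copyDue-noSource pc ins c rest n₁ n₂ n₃ n₄ =
    All.++⁺ (copyTokens-noSource rest n₁) (All.++⁺ (dispatchEdges-noSource pc (just ins) n₂ n₃) (compareTokens-noSource c n₄))

  data CompareEdge (β : Bool) (pc : ℕ) (r : Fin 2) (x y : ℕ) : Edge → Set where
    exitZero   : CompareEdge β pc r x y (round β (exhausted (up r)) , instr β onZero pc)
    exitDec    : CompareEdge β pc r x y (round β (exhausted (down r)) , instr β onDec pc)
    upToken    : ∀ {x′} → x ≡ suc x′ → CompareEdge β pc r x y (compareEdge β (up r))
    downToken  : ∀ {y′} → y ≡ suc y′ → CompareEdge β pc r x y (compareEdge β (down r))
    otherToken : ∀ φ → φ ≢ up r → φ ≢ down r → CompareEdge β pc r x y (compareEdge β φ)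

  compareOthers-edge : ∀ {β pc r c x y e} → e ∈ compareOthers β r c → CompareEdge β pc r x y e
  compareOthers-edge {β} {r = 0F} {c} e∈ with ∈-++⁻ (copies (c (up 1F)) (compareEdge β (up 1F) ∷ [])) e∈
  ... | inj₁ e∈u with copies-∈ (c (up 1F)) e∈u
  ... | here refl , _ = otherToken (up 1F) (λ ()) (λ ())
  compareOthers-edge {β} {r = 0F} {c} e∈ | inj₂ e∈d with copies-∈ (c (down 1F)) e∈d
  ... | here refl , _ = otherToken (down 1F) (λ ()) (λ ())
  compareOthers-edge {β} {r = 1F} {c} e∈ with ∈-++⁻ (copies (c (up 0F)) (compareEdge β (up 0F) ∷ [])) e∈
  ... | inj₁ e∈u with copies-∈ (c (up 0F)) e∈u
  ... | here refl , _ = otherToken (up 0F) (λ ()) (λ ())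
  compareOthers-edge {β} {r = 1F} {c} e∈ | inj₂ e∈d with copies-∈ (c (down 0F)) e∈d
  ... | here refl , _ = otherToken (down 0F) (λ ()) (λ ())

  compareDue-edge : ∀ {β pc r c x y e} → e ∈ compareDue β pc r c x y → CompareEdge β pc r x y e
  compareDue-edge {β} {pc} {r} {c} {x} {y} e∈ with ∈-++⁻ (testExits β pc r) e∈
  ... | inj₁ (here refl)         = exitZero
  ... | inj₁ (there (here refl)) = exitDec
  ... | inj₂ e∈′ with ∈-++⁻ (compareRemaining β r x y) e∈′
  ... | inj₂ e∈o = compareOthers-edge {c = c} e∈o
  ... | inj₁ e∈r with ∈-++⁻ (copies x (compareEdge β (up r) ∷ [])) e∈r
  ... | inj₁ e∈u with copies-∈ x e∈u
  ... | here refl , _ , x≡ = upToken x≡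
  compareDue-edge {β} {pc} {r} {c} {x} {y} e∈ | inj₂ _ | inj₁ _ | inj₂ e∈d with copies-∈ y e∈d
  ... | here refl , _ , y≡ = downToken y≡

  compare-takeDown : ∀ β pc r c x y J →
                     midRound β c (compareDue β pc r c x (suc y)) J ↭
                     pend 0 (compareEdge β (down r)) ∷ midRound β c (compareDue β pc r c x y) J
  compare-takeDown β pc r c x y J = midRound-pick β c (compareDue β pc r c x y) J
    (↭-trans (++⁺ˡ (testExits β pc r) (++⁺ʳ (compareOthers β r c) (shift _ (copies x (compareEdge β (up r) ∷ [])) _)))
             (shift _ (testExits β pc r) _))

  compare-takeUp : ∀ β pc r c x y J →
                   midRound β c (compareDue β pc r c (suc x) y) J ↭
                   pend 0 (compareEdge β (up r)) ∷ midRound β c (compareDue β pc r c x y) J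
  compare-takeUp β pc r c x y J = midRound-take β c (testExits β pc r) (compareEdge β (up r)) (compareRest β r c x y) J

  zeroExit-take : ∀ β pc r c x y J →
                  midRound β c (compareDue β pc r c x y) J ↭
                  pend 0 (zeroExit β pc r) ∷ midRound β c (decExit β pc r ∷ compareRest β r c x y) J
  zeroExit-take β pc r c x y J = midRound-take β c [] (zeroExit β pc r) (decExit β pc r ∷ compareRest β r c x y) J

  decExit-take : ∀ β pc r c x y J →
                 midRound β c (compareDue β pc r c x y) J ↭
                 pend 0 (decExit β pc r) ∷ midRound β c (zeroExit β pc r ∷ compareRest β r c x y) J
  decExit-take β pc r c x y J = midRound-take β c (zeroExit β pc r ∷ []) (decExit β pc r) (compareRest β r c x y) J

  perform-take : ∀ β pc c r j J →
                 midRound β c (dispatchDue β pc (inc r j) c) J ↭ pend 0 (performEdge β pc) ∷ midRound β c (compareTokens β c) J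
  perform-take β pc c r j J = midRound-take β c [] (performEdge β pc) (compareTokens β c) J

  test-take : ∀ β pc c r z j J →
              midRound β c (dispatchDue β pc (dec r z j) c) J ↭
              pend 0 (testEdge β r) ∷ midRound β c (compareDue β pc r c (c (up r)) (c (down r))) J
  test-take β pc c r z j J =
    ↭-trans (midRound-take β c [] (testEdge β r) (testExits β pc r ++ compareTokens β c) J)
            (↭-prep _ (midRound-reorder β c J (++⁺ˡ (testExits β pc r) (compareTokens-split β r c))))

  urgent-blocks : ∀ {Ψ L L′ s q} → nored Ψ (enc s) → map strip Ψ ↭ L → L ↭ pend 0 (s , q) ∷ L′ → ⊥
  urgent-blocks nr h p = nored-strip⁻ nr h (∈-resp-↭ (↭-sym p) (here refl)) (refl , refl)

  wait-not-InRound : ∀ {γ s} → InRound γ s → wait ≢ s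
  wait-not-InRound (stage g)   ()
  wait-not-InRound (step k pc) ()

  round-due-stale : ∀ {β γ} {e : Edge} → (∃ λ g → proj₁ e ≡ round γ g) → StaleTriple β (pend 0 e)
  round-due-stale {γ = γ} (g , refl) = inj₁ (refl , λ e → wait-not-InRound (stage {γ} g) (sym (enc-injective e)))

  guard-stale : ∀ {β s} → InRound β s → StaleTriple (not β) (pend 1 (s , dead))
  guard-stale {β} {s} inR = inj₂ (refl , s , refl , β , inR , not-¬ refl)

  junk-stale : ∀ {β γ t} → Due t × Foreign γ (origin t) → StaleTriple β t
  junk-stale (t0 , s , o≡ , γ , inR , _) = inj₁ (t0 , λ e → wait-not-InRound inR (enc-injective (trans (sym e) o≡)))

  leftover-stale : ∀ {β L J} → RoundSourced β L → Junk β J → Stale (not β) (at 0 L ++ armed β J)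
  leftover-stale {β} sourced junk =
    All.++⁺ (All.map⁺ (All.map (λ {e} → round-due-stale {not β} {β} {e}) sourced))
            (All.++⁺ (All.map⁺ (All.map⁺ (All.map guard-stale (roundLocs-InRound β N))))
                     (All.map (λ {t} → junk-stale {not β} {β} {t}) junk))

  jump-pending : ∀ {Ψ Ψ′} β c c′ W S L J → map delayed W ++ at 1 (units (not β) c) ↭ at 1 (units (not β) c′) →
                 map strip Ψ ↭ midRound β c L J → map strip Ψ′ ≡ map delayed (W ++ S) ++ map strip Ψ →
                 map strip Ψ′ ↭ at 1 (units (not β) c′) ++ (map delayed S ++ (at 0 L ++ armed β J))
  jump-pending {Ψ} {Ψ′} β c c′ W S L J put h e = begin
    map strip Ψ′                  ≡⟨ trans e (cong (_++ map strip Ψ) (map-++ delayed W S)) ⟩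
    (mW ++ mS) ++ map strip Ψ     ↭⟨ ++⁺ˡ (mW ++ mS) h ⟩
    (mW ++ mS) ++ (U ++ R)        ≡⟨ ++-assoc mW mS (U ++ R) ⟩
    mW ++ (mS ++ (U ++ R))        ↭⟨ ++⁺ˡ mW (shifts mS U) ⟩
    mW ++ (U ++ (mS ++ R))        ≡⟨ sym (++-assoc mW U (mS ++ R)) ⟩
    (mW ++ U) ++ (mS ++ R)        ↭⟨ ++⁺ʳ (mS ++ R) put ⟩
    at 1 (units (not β) c′) ++ (mS ++ R) ∎
    where
    open Perm.PermutationReasoning
    mW mS U R : List Triple
    mW = map delayed W
    mS = map delayed S
    U = at 1 (units (not β) c)
    R = at 0 L ++ armed β J

  step-booting : ∀ {cf} → ⟨ enc boot , nothing , [] ⟩ ⟶ₛ cf → Inv cf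
  step-booting (function f f∈ from≡ _) = call-outcome {boot} f∈ from≡ on-call
    where
    on-call : OnCall boot []
    on-call (here refl) Ψ′ e = Resumes-outcome ε (λ _ → z≤n) (jump-resumes true 0 (λ _ → 0) [] Ψ′ [] (↭-reflexive e))
  step-booting (event-match p h _ _) = ⊥-elim (¬x∷xs↭[] (↭-sym h))
  step-booting (tick _)              = inj₂ booting

  step-buried : ∀ {Ψ cf} → All (λ e → src e ≢ enc dead) Ψ → ⟨ enc dead , nothing , Ψ ⟩ ⟶ₛ cf → Inv cf
  step-buried _ (function f f∈ from≡ _) with spec-of {f} {dead} f∈ from≡
  ... | _ , () , _
  step-buried silent (event-match p h _ src≡) = ⊥-elim (All.lookup silent (∈-resp-↭ (↭-sym h) (here refl)) src≡)
  step-buried {Ψ} silent (tick _)             = inj₂ (buried (↓-All-src Ψ silent))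

  Doomed-blocks : ∀ {n Ψ} → Doomed n Ψ → ¬ nored Ψ n
  Doomed-blocks d nr with Doomed.urgent d
  ... | e , e∈ , t0 , s0 = All.lookup nr e∈ (t0 , s0)

  step-doomed : ∀ {n Ψ cf} → Doomed n Ψ → ⟨ n , nothing , Ψ ⟩ ⟶ₛ cf → Inv cf
  step-doomed d (function _ _ _ nr) = ⊥-elim (Doomed-blocks d nr)
  step-doomed d (tick nr)           = ⊥-elim (Doomed-blocks d nr)
  step-doomed d (event-match p h t0 s0) =
    inj₂ (subst (λ n → Phase n _) (sym (All.lookup (Doomed.to-dead d) (∈-resp-↭ (↭-sym h) (here refl)) t0 s0))
                (buried (All-remove h (Doomed.dead-silent d))))

  step-boundary : ∀ {Ψ cf} β pc c ins R → Simulated pc c ins → map strip Ψ ↭ atBoundary β pc ins c ++ R → Stale β R →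
                  ⟨ enc wait , nothing , Ψ ⟩ ⟶ₛ cf → Inv cf
  step-boundary β pc c ins R sim h stale (function f f∈ from≡ _) with spec-of {f} {wait} f∈ from≡
  ... | _ , () , _
  step-boundary β pc c ins R sim h stale (event-match p h₁ t0 s0) =
    ⊥-elim (boundary-calm {β} {pc} {ins} {c} {R} stale (strip-∈ h₁ h) (t0 , s0))
  step-boundary β pc c ins R sim h stale (tick _) =
    inj₂ (started β pc c ins (R ↓ᵗ) sim (boundary-tick β pc ins c R h) (Stale-↓ᵗ R stale))

  step-started : ∀ {Ψ cf} β pc c ins J → Simulated pc c ins → map strip Ψ ↭ afterTick β pc ins c J → Junk β J →
                 ⟨ enc wait , nothing , Ψ ⟩ ⟶ₛ cf → Inv cf
  step-started β pc c ins J sim h junk (function f f∈ from≡ _) with spec-of {f} {wait} f∈ from≡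
  ... | _ , () , _
  step-started β pc c ins J sim h junk (tick nr) =
    ⊥-elim (urgent-blocks nr h (started-take β pc ins c J))
  step-started β pc c ins J sim h junk (event-match {Ψ' = Ψ′} p h₁ t0 s0)
    with ∈-resp-↭ (started-take β pc ins c J) (strip-∈ {L = afterTick β pc ins c J} h₁ h)
  ... | here e = inj₂ (subst (λ n → Phase n Ψ′) (sym (cong goal e))
                   (copying β pc c ins J c (λ _ → 0) sim (λ φ → +-identityʳ (c φ))
                            (strip-remove h₁ h (started-take β pc ins c J) e) junk))
  ... | there t∈ = ⊥-elim (midRound-calm {s = wait} {d = λ _ → 0} {copyDue β pc ins c c} (λ ()) junk
                     (copyDue-noSource {s = wait} pc ins c c (λ ()) (λ ()) (λ _ ()) (λ _ ())) t∈ (t0 , s0))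

  step-copying : ∀ {Ψ cf} β pc c ins J rest done → Simulated pc c ins → Split rest done c →
                 map strip Ψ ↭ midRound β done (copyDue β pc ins c rest) J → Junk β J →
                 ⟨ enc (round β copy) , nothing , Ψ ⟩ ⟶ₛ cf → Inv cf
  step-copying {Ψ} β pc c ins J rest done sim split h junk (function f f∈ from≡ nr) =
    call-outcome {round β copy} f∈ from≡ on-call
    where
    rest-empty : ∀ φ → rest φ ≡ 0
    rest-empty φ with rest φ in e
    ... | zero  = refl
    ... | suc k = ⊥-elim (urgent-blocks nr h (copy-take β pc ins c done rest φ k J e))
    on-call : OnCall (round β copy) Ψ
    on-call (here refl) Ψ′ e = inj₂ (dispatching β pc c ins J sim
      (↭-trans (↭-reflexive e) (↭-trans h (↭-reflexive (copying-exit β pc ins c done rest J split rest-empty)))) junk)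
  step-copying β pc c ins J rest done sim split h junk (tick _) =
    inj₂ (doomed (tick-dooms done (copyDue β pc ins c rest) J (stage copy) (round-∈ β copy) junk h))
  step-copying β pc c ins J rest done sim split h junk (event-match {Ψ' = Ψ′} p h₁ t0 s0)
    with midRound-urgent {d = done} {copyDue β pc ins c rest} (local (stage copy)) junk (strip-∈ h₁ h) (t0 , s0)
  ... | q , sq∈ , e with ∈-++⁻ (copyTokens β rest) sq∈
  ... | inj₂ sq∈′ = ⊥-elim (NoSource-∉ (All.++⁺ (dispatchEdges-noSource pc (just ins) (λ ()) (λ _ ()))
                                                (compareTokens-noSource c (λ _ ()))) sq∈′)
  ... | inj₁ sq∈c with byFamily-∈ rest {λ ψ → copyEdge β ψ ∷ []} sq∈c
  ... | φ , here refl , k , ek = inj₂ (subst (λ n → Phase n Ψ′) (sym (cong goal e))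
          (respawning β pc c ins J (rest [ φ ≔ k ]) done φ sim (Split-move {rest} {done} {c} {φ} {k} split ek)
                      (strip-remove h₁ h (copy-take β pc ins c done rest φ k J ek) e) junk))

  step-respawning : ∀ {Ψ cf} β pc c ins J rest done φ → Simulated pc c ins → Split rest (done [ φ ≔ suc (done φ) ]) c →
                    map strip Ψ ↭ midRound β done (copyDue β pc ins c rest) J → Junk β J →
                    ⟨ enc (round β (copied φ)) , nothing , Ψ ⟩ ⟶ₛ cf → Inv cf
  step-respawning {Ψ} β pc c ins J rest done φ sim split h junk (function f f∈ from≡ _) =
    call-outcome {round β (copied φ)} f∈ from≡ on-call
    where
    on-call : OnCall (round β (copied φ)) Ψ
    on-call (here refl) Ψ′ e = inj₂ (copying β pc c ins J rest (done [ φ ≔ suc (done φ) ]) sim split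
      (↭-trans (↭-reflexive e) (↭-trans (++⁺ˡ _ h) (respawn β done φ (copyDue β pc ins c rest) J))) junk)
  step-respawning β pc c ins J rest done φ sim split h junk (tick _) =
    inj₂ (doomed (tick-dooms done (copyDue β pc ins c rest) J (stage (copied φ)) (round-∈ β (copied φ)) junk h))
  step-respawning β pc c ins J rest done φ sim split h junk (event-match p h₁ t0 s0) =
    ⊥-elim (midRound-calm {d = done} {copyDue β pc ins c rest} (local (stage (copied φ))) junk
              (copyDue-noSource {s = round β (copied φ)} pc ins c rest (λ ()) (λ ()) (λ _ ()) (λ _ ())) (strip-∈ h₁ h) (t0 , s0))

  reaches-inc : ∀ {pc c r j} → Simulated pc c (inc r j) → Reaches j (increment c r)
  reaches-inc {c = c} {r} {j} (ins≡ , reaches , bal) =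
    subst (λ v → Star (MStep P) start (j , v)) (sym (registers-increment c r bal)) (reaches ◅◅ (m-inc ins≡ ◅ ε))

  reaches-zero : ∀ {pc c r z j} → Simulated pc c (dec r z j) → c (down r) ≡ c (up r) → Reaches z c
  reaches-zero {c = c} {r} (ins≡ , reaches , _) down≡up = reaches ◅◅ (m-zero ins≡ (lookup-registers-zero c r down≡up) ◅ ε)

  reaches-dec : ∀ {pc c r z j x} → Simulated pc c (dec r z j) → suc x + c (down r) ≡ c (up r) → Reaches j (decrement c r)
  reaches-dec {c = c} {r} {j = j} (ins≡ , reaches , _) up≡ =
    subst (λ v → Star (MStep P) start (j , v)) (sym (registers-decrement c r up≡))
          (reaches ◅◅ (m-dec ins≡ (lookup-registers-suc c r up≡) ◅ ε))

  step-dispatching : ∀ {Ψ cf} β pc c ins J → Simulated pc c ins → map strip Ψ ↭ midRound β c (dispatchDue β pc ins c) J →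
                     Junk β J → ⟨ enc (round β dispatch) , nothing , Ψ ⟩ ⟶ₛ cf → Inv cf
  step-dispatching β pc c ins J sim h junk (function f f∈ from≡ _) with spec-of {f} {round β dispatch} f∈ from≡
  ... | _ , () , _
  step-dispatching β pc c (inc r j) J sim h junk (tick nr) =
    ⊥-elim (urgent-blocks nr h (perform-take β pc c r j J))
  step-dispatching β pc c (dec r z j) J sim h junk (tick nr) =
    ⊥-elim (urgent-blocks nr h (test-take β pc c r z j J))
  step-dispatching β pc c ins J sim h junk (event-match {Ψ' = Ψ′} p h₁ t0 s0)
    with midRound-urgent {d = c} {dispatchDue β pc ins c} (local (stage dispatch)) junk (strip-∈ h₁ h) (t0 , s0)
  ... | q , sq∈ , e with ins | sim | ∈-++⁻ (dispatchEdges β pc (just ins)) sq∈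
  ... | inc r j | sim′@(eq , _ , bal) | inj₁ (here refl) = inj₂ (subst (λ n → Phase n Ψ′) (sym (cong goal e))
          (finishing β onInc pc j c (increment c r) (scheduled 0 (unit (not β) (up r))) (compareTokens β c) J
             (instrAt-< P pc eq) (cong (instrSpecs β onInc pc) eq) (units-put-scheduled (not β) c (up r))
             (reaches-inc {c = c} {r} sim′)
             (Balanced-increment c r bal) (compareTokens-sourced β c)
             (strip-remove h₁ h (perform-take β pc c r j J) e) junk))
  ... | dec r z j | sim′@(_ , _ , bal) | inj₁ (here refl) = inj₂ (subst (λ n → Phase n Ψ′) (sym (cong goal e))
          (comparing β pc c r z j J (c (up r)) (c (down r)) onUp sim′ (bal r , +-comm (c (up r)) (c (down r)))
             (strip-remove h₁ h (test-take β pc c r z j J) e) junk))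
  ... | dec r z j | _ | inj₁ (there sq∈′) = ⊥-elim (NoSource-∉ (testExits-noSource pc r (λ _ ())) sq∈′)
  ... | _ | _ | inj₂ sq∈′ = ⊥-elim (NoSource-∉ (compareTokens-noSource c (λ _ ())) sq∈′)

  compare-noSource-compared : ∀ β pc r c x y φ → NoSource (round β (compared φ)) (compareDue β pc r c x y)
  compare-noSource-compared β pc r c x y φ =
    All.++⁺ (testExits-noSource pc r (λ _ ()))
            (All.++⁺ (compareRemaining-noSource r x y (λ _ ())) (compareOthers-noSource r c (λ _ ())))

  compareRest-sourced : ∀ β r c x y → RoundSourced β (compareRest β r c x y)
  compareRest-sourced β r c x y = All.++⁺ (compareRemaining-sourced β r x y) (compareOthers-sourced β r c)

  compare-fire : ∀ {Ψ Ψ′ p} β pc c r z j J a x y {q} → Simulated pc c (dec r z j) → CompareInv a x y (c (up r)) (c (down r)) →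
                 Junk β J → CompareEdge β pc r x y (round β (compareAt a r) , q) →
                 map strip Ψ ↭ midRound β c (compareDue β pc r c x y) J → Ψ ↭ p ∷ Ψ′ →
                 strip p ≡ pend 0 (round β (compareAt a r) , q) → Phase (enc q) Ψ′
  compare-fire β pc c r z j J onUp (suc x) y sim inv junk (upToken refl) h h₁ e =
    comparing β pc c r z j J x y afterUp sim inv
              (strip-remove h₁ h (compare-takeUp β pc r c x y J) e) junk
  compare-fire β pc c r z j J onUp x y sim inv junk (otherToken _ ne _) h h₁ e = ⊥-elim (ne refl)
  compare-fire β pc c r z j J onDown x (suc y) sim (le , eq) junk (downToken refl) h h₁ e =
    comparing β pc c r z j J x y afterDown sim (s≤s⁻¹ le , suc-injective eq)
              (strip-remove h₁ h (compare-takeDown β pc r c x y J) e) junk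
  compare-fire β pc c r z j J onDown x y sim inv junk (otherToken _ _ ne) h h₁ e = ⊥-elim (ne refl)
  compare-fire β pc c r z j J doneUp x y sim@(ins≡ , _ , bal) (x≡0 , y≤x , eq) junk exitZero h h₁ e =
    finishing β onZero pc z c c [] (decExit β pc r ∷ compareRest β r c x y) J (instrAt-< P pc ins≡)
              (cong (instrSpecs β onZero pc) ins≡) ↭-refl (reaches-zero {c = c} {r} sim down≡up) bal
              ((_ , refl) ∷ compareRest-sourced β r c x y)
              (strip-remove h₁ h (zeroExit-take β pc r c x y J) e) junk
    where
    down≡up : c (down r) ≡ c (up r)
    down≡up = subst₂ (λ u v → u + c (down r) ≡ v + c (up r)) x≡0 (n≤0⇒n≡0 (subst (y ≤_) x≡0 y≤x)) eq
  compare-fire β pc c r z j J doneDown x y sim@(ins≡ , _ , bal) (y≡0 , eq) junk exitDec h h₁ e =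
    finishing β onDec pc j c (decrement c r) (scheduled 0 (unit (not β) (down r))) (zeroExit β pc r ∷ compareRest β r c x y) J
              (instrAt-< P pc ins≡) (cong (instrSpecs β onDec pc) ins≡) (units-put-scheduled (not β) c (down r))
              (reaches-dec {c = c} {r} {x = x} sim up≡) (Balanced-decrement c r bal up≡) ((_ , refl) ∷ compareRest-sourced β r c x y)
              (strip-remove h₁ h (decExit-take β pc r c x y J) e) junk
    where
    up≡ : suc x + c (down r) ≡ c (up r)
    up≡ = subst (λ v → suc x + c (down r) ≡ v + c (up r)) y≡0 eq

  step-comparing : ∀ {Ψ cf} β pc c r z j J x y a → Simulated pc c (dec r z j) → CompareInv a x y (c (up r)) (c (down r)) →
                   map strip Ψ ↭ midRound β c (compareDue β pc r c x y) J → Junk β J →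
                   ⟨ enc (round β (compareAt a r)) , nothing , Ψ ⟩ ⟶ₛ cf → Inv cf
  step-comparing β pc c r z j J x y doneUp sim inv h junk (tick nr) =
    ⊥-elim (urgent-blocks nr h (zeroExit-take β pc r c x y J))
  step-comparing β pc c r z j J x y doneDown sim inv h junk (tick nr) =
    ⊥-elim (urgent-blocks nr h (decExit-take β pc r c x y J))
  step-comparing β pc c r z j J x y a sim inv h junk (tick _) =
    inj₂ (doomed (tick-dooms c (compareDue β pc r c x y) J (stage (compareAt a r)) (round-∈ β _) junk h))
  step-comparing {Ψ} β pc c r z j J zero y onUp sim inv h junk (function f f∈ from≡ _) =
    call-outcome {round β (compare (up r))} f∈ from≡ λ { (here refl) Ψ′ e →
      inj₂ (comparing β pc c r z j J 0 y doneUp sim (refl , inv) (↭-trans (↭-reflexive e) h) junk) }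
  step-comparing β pc c r z j J (suc x) y onUp sim inv h junk (function f f∈ from≡ nr) =
    ⊥-elim (urgent-blocks nr h (compare-takeUp β pc r c x y J))
  step-comparing β pc c r z j J x zero onDown sim inv h junk (function f f∈ from≡ _) =
    call-outcome {round β (compare (down r))} f∈ from≡ λ { (here refl) Ψ′ e →
      inj₂ (comparing β pc c r z j J x 0 doneDown sim (refl , proj₂ inv) (↭-trans (↭-reflexive e) h) junk) }
  step-comparing β pc c r z j J x (suc y) onDown sim inv h junk (function f f∈ from≡ nr) =
    ⊥-elim (urgent-blocks nr h (compare-takeDown β pc r c x y J))
  step-comparing β pc c r z j J x y afterUp sim inv h junk (function f f∈ from≡ _) =
    call-outcome {round β (compared (up r))} f∈ from≡ λ { (here refl) Ψ′ e →
      inj₂ (comparing β pc c r z j J x y onDown sim inv (↭-trans (↭-reflexive e) h) junk) }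
  step-comparing β pc c r z j J x y afterDown sim inv h junk (function f f∈ from≡ _) =
    call-outcome {round β (compared (down r))} f∈ from≡ λ { (here refl) Ψ′ e →
      inj₂ (comparing β pc c r z j J x y onUp sim inv (↭-trans (↭-reflexive e) h) junk) }
  step-comparing β pc c r z j J x y doneUp sim inv h junk (function f f∈ from≡ _)
    with spec-of {f} {round β (exhausted (up r))} f∈ from≡
  ... | _ , () , _
  step-comparing β pc c r z j J x y doneDown sim inv h junk (function f f∈ from≡ _)
    with spec-of {f} {round β (exhausted (down r))} f∈ from≡
  ... | _ , () , _
  step-comparing β pc c r z j J x y a sim inv h junk (event-match {Ψ' = Ψ′} p h₁ t0 s0)
    with midRound-urgent {d = c} {compareDue β pc r c x y} (local (stage (compareAt a r))) junk (strip-∈ h₁ h) (t0 , s0)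
  ... | q , sq∈ , e = inj₂ (subst (λ n → Phase n Ψ′) (sym (cong goal e))
                               (compare-fire β pc c r z j J a x y sim inv junk (compareDue-edge {c = c} sq∈) h h₁ e))

  step-finishing : ∀ {Ψ cf} β k pc j c c′ W L J → pc < N → specsAt (instr β k pc) ≡ jump β j W (instr β k pc) ∷ [] →
                   map delayed W ++ at 1 (units (not β) c) ↭ at 1 (units (not β) c′) → Reaches j c′ → Balanced c′ →
                   RoundSourced β L → map strip Ψ ↭ midRound β c L J → Junk β J →
                   ⟨ enc (instr β k pc) , nothing , Ψ ⟩ ⟶ₛ cf → Inv cf
  step-finishing {Ψ} β k pc j c c′ W L J pc<N spec≡ put reaches bal sourced h junk (function f f∈ from≡ _) =
    call-outcome {instr β k pc} f∈ from≡ on-call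
    where
    on-call : OnCall (instr β k pc) Ψ
    on-call g∈ Ψ′ e with subst (_ ∈_) spec≡ g∈
    ... | here refl = Resumes-outcome reaches bal (jump-resumes β j c′ (at 0 L ++ armed β J) Ψ′ (leftover-stale sourced junk)
                        (jump-pending β c c′ W (scheduleNext (not β) j) L J put h e))
  step-finishing β k pc j c c′ W L J pc<N spec≡ put reaches bal sourced h junk (tick _) =
    inj₂ (doomed (tick-dooms c L J (step k pc) (instr-round-∈ β k pc<N) junk h))
  step-finishing β k pc j c c′ W L J pc<N spec≡ put reaches bal sourced h junk (event-match p h₁ t0 s0) =
    ⊥-elim (midRound-calm {d = c} {L} (local (step k pc)) junk (RoundSourced-noSource sourced λ _ ())
                          (strip-∈ h₁ h) (t0 , s0))

  step-phase : ∀ {n Ψ cf} → Phase n Ψ → ⟨ n , nothing , Ψ ⟩ ⟶ₛ cf → Inv cf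
  step-phase booting                                   = step-booting
  step-phase (boundary β pc c ins R sim h stale)       = step-boundary β pc c ins R sim h stale
  step-phase (started β pc c ins J sim h junk)         = step-started β pc c ins J sim h junk
  step-phase (copying β pc c ins J rest done sim sp h junk)
    = step-copying β pc c ins J rest done sim sp h junk
  step-phase (respawning β pc c ins J rest done φ sim sp h junk)
    = step-respawning β pc c ins J rest done φ sim sp h junk
  step-phase (dispatching β pc c ins J sim h junk)     = step-dispatching β pc c ins J sim h junk
  step-phase (comparing β pc c r z j J x y a sim inv h junk)
    = step-comparing β pc c r z j J x y a sim inv h junk
  step-phase (finishing β k pc j c c′ W L J pc<N spec≡ put reaches bal sourced h junk)
    = step-finishing β k pc j c c′ W L J pc<N spec≡ put reaches bal sourced h junk
  step-phase (doomed d)                                = step-doomed d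
  step-phase (buried silent)                           = step-buried silent

  Inv-step : ∀ {cf cf′} → cf ⟶ₛ cf′ → Inv cf → Inv cf′
  Inv-step state-change               inv        = inv
  Inv-step (function _ _ _ _)         (inj₁ hlt) = inj₁ hlt
  Inv-step (event-match _ _ _ _)      (inj₁ hlt) = inj₁ hlt
  Inv-step (tick _)                   (inj₁ hlt) = inj₁ hlt
  Inv-step t@(function _ _ _ _)       (inj₂ ph)  = step-phase ph t
  Inv-step t@(event-match _ _ _ _)    (inj₂ ph)  = step-phase ph t
  Inv-step t@(tick _)                 (inj₂ ph)  = step-phase ph t

  Inv-run : ∀ {cf cf′} → Run cf cf′ → Inv cf → Inv cf′
  Inv-run ε        inv = inv
  Inv-run (t ◅ ts) inv = Inv-run ts (Inv-step t inv)

  Phase-not-halt : ∀ {n Ψ} → Phase n Ψ → n ≢ enc halt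
  Phase-not-halt booting                                        = enc-distinct λ ()
  Phase-not-halt (boundary _ _ _ _ _ _ _ _)                     = enc-distinct λ ()
  Phase-not-halt (started _ _ _ _ _ _ _ _)                      = enc-distinct λ ()
  Phase-not-halt (copying β _ _ _ _ _ _ _ _ _ _)                e = InRound-not-halt (stage {β} copy) (enc-injective e)
  Phase-not-halt (respawning β _ _ _ _ _ _ φ _ _ _ _)           e = InRound-not-halt (stage {β} (copied φ)) (enc-injective e)
  Phase-not-halt (dispatching β _ _ _ _ _ _ _)                  e = InRound-not-halt (stage {β} dispatch) (enc-injective e)
  Phase-not-halt (comparing β _ _ r _ _ _ _ _ a _ _ _ _)        e = InRound-not-halt (stage {β} (compareAt a r)) (enc-injective e)
  Phase-not-halt (finishing β k pc _ _ _ _ _ _ _ _ _ _ _ _ _ _) e = InRound-not-halt (step {β} k pc) (enc-injective e)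
  Phase-not-halt (doomed d)                                     = Doomed.not-halt d
  Phase-not-halt (buried _)                                     = enc-distinct λ ()

  soundness : Reachable simulator (enc halt) → Halts P
  soundness (Ψ , run) with Inv-run run (inj₂ booting)
  ... | inj₁ hlt = hlt
  ... | inj₂ ph  = ⊥-elim (Phase-not-halt ph refl)

  record Reaching (n : State) (Ψ : List Event) (n′ : State) (Q : List Event → Set) : Set where
    constructor reaching
    field
      {pending} : List Event
      run       : Run ⟨ n , nothing , Ψ ⟩ ⟨ n′ , nothing , pending ⟩
      holds     : Q pending

  stay : ∀ {n Ψ} {Q : List Event → Set} → Q Ψ → Reaching n Ψ n Q
  stay q = reaching ε q

  _▷_ : ∀ {n Ψ n′ n″} {Q R : List Event → Set} → Reaching n Ψ n′ Q → (∀ {Ψ′} → Q Ψ′ → Reaching n′ Ψ′ n″ R) →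
        Reaching n Ψ n″ R
  reaching run q ▷ k with k q
  ... | reaching run′ r = reaching (run ◅◅ run′) r
  infixl 4 _▷_

  fire : ∀ {Ψ L} s q → map strip Ψ ↭ pend 0 (s , q) ∷ L → Reaching (enc s) Ψ (enc q) (λ Ψ′ → map strip Ψ′ ↭ L)
  fire {Ψ} s q h with strip-pick h
  ... | p , Ψ′ , perm , e , h′ =
    reaching (subst (λ n → Run _ ⟨ n , nothing , Ψ′ ⟩) (cong goal e)
                    (event-match p perm (cong delay e) (cong origin e) ◅ state-change ◅ ε)) h′

  call : ∀ {Ψ s g} → s ∈ sources → g ∈ specsAt s → nored Ψ (enc s) →
         Reaching (enc s) Ψ (enc (post g)) (λ Ψ′ → map strip Ψ′ ≡ map delayed (spawns g) ++ map strip Ψ)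
  call {Ψ} {s} s∈ g∈ nr with function-of s∈ g∈
  ... | f , f∈ , from≡ , to≡ , spawns≡ =
    reaching (subst (λ n → Run _ ⟨ n , nothing , events f ++ Ψ ⟩) to≡
                    (function f f∈ (trans from≡ (cong enc (pre-specsAt s g∈))) nr ◅ state-change ◅ ε))
             (trans (map-++ strip (events f) Ψ) (cong (_++ map strip Ψ) spawns≡))

  tick-step : ∀ {n Ψ} → nored Ψ n → Reaching n Ψ n (λ Ψ′ → Ψ′ ≡ Ψ ↓)
  tick-step nr = reaching (tick nr ◅ ε) refl

  midRound-nored : ∀ {β s d L J Ψ} → Local β s → Junk β J → (∀ {q} → (s , q) ∈ L → ⊥) →
                   map strip Ψ ↭ midRound β d L J → nored Ψ (enc s)
  midRound-nored {d = d} {L} loc junk absent h =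
    nored-strip h λ t∈ u → absent (proj₁ (proj₂ (midRound-urgent {d = d} {L} loc junk t∈ u)))

  copy-all : ∀ n {Ψ} β pc ins c J rest done → total rest ≡ n → Split rest done c → Junk β J →
             map strip Ψ ↭ midRound β done (copyDue β pc ins c rest) J →
             Reaching (enc (round β copy)) Ψ (enc (round β dispatch))
                      (λ Ψ′ → map strip Ψ′ ↭ midRound β c (dispatchDue β pc ins c) J)
  copy-all n {Ψ} β pc ins c J rest done tot split junk h with empty-or-positive rest
  ... | inj₁ empty =
    call (round-source β copy) (here refl)
         (midRound-nored {d = c} {dispatchDue β pc ins c} (local (stage copy)) junk (NoSource-∉ no-copy) h′)
    ▷ λ e → stay (↭-trans (↭-reflexive e) h′)
    where
    h′ : map strip Ψ ↭ midRound β c (dispatchDue β pc ins c) J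
    h′ = ↭-trans h (↭-reflexive (copying-exit β pc ins c done rest J split empty))
    no-copy : NoSource (round β copy) (dispatchDue β pc ins c)
    no-copy = All.++⁺ (dispatchEdges-noSource pc (just ins) (λ ()) (λ _ ())) (compareTokens-noSource c (λ _ ()))
  copy-all zero    β pc ins c J rest done tot split junk h | inj₂ (φ , k , ek) =
    ⊥-elim (0≢1+n (trans (sym tot) (total-update rest φ k ek)))
  copy-all (suc n) β pc ins c J rest done tot split junk h | inj₂ (φ , k , ek) =
    fire (round β copy) (round β (copied φ)) (↭-trans h (copy-take β pc ins c done rest φ k J ek))
    ▷ λ h₁ → call (round-source β (copied φ)) (here refl)
                  (midRound-nored {d = done} {copyDue β pc ins c (rest [ φ ≔ k ])} (local (stage (copied φ))) junk
                     (NoSource-∉ (copyDue-noSource {β} {round β (copied φ)} pc ins c (rest [ φ ≔ k ])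
                                                    (λ ()) (λ ()) (λ _ ()) (λ _ ()))) h₁)
    ▷ λ e → copy-all n β pc ins c J (rest [ φ ≔ k ]) (done [ φ ≔ suc (done φ) ])
              (suc-injective (trans (sym (total-update rest φ k ek)) tot)) (Split-move {rest} {done} {c} {φ} {k} split ek) junk
              (↭-trans (↭-reflexive e) (↭-trans (++⁺ˡ _ h₁) (respawn β done φ (copyDue β pc ins c (rest [ φ ≔ k ])) J)))

  compareDue-no-up : ∀ β pc r c y {q} → (round β (compare (up r)) , q) ∈ compareDue β pc r c 0 y → ⊥
  compareDue-no-up β pc r c y m with compareDue-edge {c = c} {x = 0} {y} m
  ... | upToken ()
  ... | otherToken _ ne _ = ne refl

  compareDue-no-down : ∀ β pc r c x {q} → (round β (compare (down r)) , q) ∈ compareDue β pc r c x 0 → ⊥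
  compareDue-no-down β pc r c x m with compareDue-edge {c = c} {x = x} {0} m
  ... | downToken ()
  ... | otherToken _ _ ne = ne refl

  module Comparison (β : Bool) (pc : ℕ) (r : Fin 2) (c : Counts) (J : List Triple) (junk : Junk β J) where

    At : ℕ → ℕ → List Event → Set
    At x y Ψ = map strip Ψ ↭ midRound β c (compareDue β pc r c x y) J

    data Compared (n : State) (Ψ₀ : List Event) : Set where
      isZero     : ∀ y → c (down r) ≡ c (up r) →
                   Reaching n Ψ₀ (enc (round β (exhausted (up r)))) (At 0 y) → Compared n Ψ₀
      isPositive : ∀ x → suc x + c (down r) ≡ c (up r) →
                   Reaching n Ψ₀ (enc (round β (exhausted (down r)))) (At x 0) → Compared n Ψ₀

    respond : ∀ {x y Ψ} φ → At x y Ψ → Reaching (enc (round β (compared φ))) Ψ (enc (round β (compare (flip φ)))) (At x y)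
    respond {x} {y} φ h =
      call (round-source β (compared φ)) (here refl)
           (midRound-nored {d = c} {compareDue β pc r c x y} (local (stage (compared φ))) junk
                           (NoSource-∉ (compare-noSource-compared β pc r c x y φ)) h)
      ▷ λ e → stay (↭-trans (↭-reflexive e) h)

    compare-up : ∀ y {n Ψ₀} x → y ≤ x → x + c (down r) ≡ y + c (up r) →
                 Reaching n Ψ₀ (enc (round β (compare (up r)))) (At x y) → Compared n Ψ₀
    compare-down : ∀ y {n Ψ₀} x → y ≤ suc x → suc x + c (down r) ≡ y + c (up r) →
                   Reaching n Ψ₀ (enc (round β (compare (down r)))) (At x y) → Compared n Ψ₀

    compare-up y zero y≤0 eq prefix = isZero y (subst (λ v → c (down r) ≡ v + c (up r)) (n≤0⇒n≡0 y≤0) eq)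
      (prefix ▷ λ h → call (round-source β (compare (up r))) (here refl)
                        (midRound-nored {d = c} {compareDue β pc r c 0 y} (local (stage (compare (up r)))) junk
                                        (compareDue-no-up β pc r c y) h)
                      ▷ λ e → stay (↭-trans (↭-reflexive e) h))
    compare-up y (suc x) le eq prefix = compare-down y x le eq
      (prefix ▷ λ h → fire (round β (compare (up r))) (round β (compared (up r)))
                        (↭-trans h (compare-takeUp β pc r c x y J))
                      ▷ respond {x} {y} (up r))

    compare-down zero x _ eq prefix = isPositive x eq
      (prefix ▷ λ h → call (round-source β (compare (down r))) (here refl)
                        (midRound-nored {d = c} {compareDue β pc r c x 0} (local (stage (compare (down r)))) junk
                                        (compareDue-no-down β pc r c x) h)
                      ▷ λ e → stay (↭-trans (↭-reflexive e) h))
    compare-down (suc y) x le eq prefix = compare-up y x (s≤s⁻¹ le) (suc-injective eq)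
      (prefix ▷ λ h → fire (round β (compare (down r))) (round β (compared (down r)))
                        (↭-trans h (compare-takeDown β pc r c x y J))
                      ▷ respond {x} {y} (down r))

  open Comparison using (isZero; isPositive)

  finish : ∀ {Ψ} β k pc j c c′ W L J → pc < N → specsAt (instr β k pc) ≡ jump β j W (instr β k pc) ∷ [] →
           map delayed W ++ at 1 (units (not β) c) ↭ at 1 (units (not β) c′) → RoundSourced β L → Junk β J →
           map strip Ψ ↭ midRound β c L J →
           Reaching (enc (instr β k pc)) Ψ (enc (afterJump (instrAt P j))) (Resumes (not β) j c′)
  finish β k pc j c c′ W L J pc<N spec≡ put sourced junk h =
    call {g = jump β j W (instr β k pc)} (roundLoc-source (instr-round-∈ β k pc<N))
         (subst (jump β j W (instr β k pc) ∈_) (sym spec≡) (here refl))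
         (midRound-nored {d = c} {L} (local (step k pc)) junk (NoSource-∉ (RoundSourced-noSource sourced λ _ ())) h)
    ▷ λ e → stay (jump-resumes β j c′ (at 0 L ++ armed β J) _ (leftover-stale sourced junk)
                   (jump-pending β c c′ W (scheduleNext (not β) j) L J put h e))

  RoundDone : Bool → List Event → MConfig → Set
  RoundDone β Ψ (pc′ , v) = ∃ λ c′ → v ≡ registers c′ × Balanced c′ ×
                            Reaching (enc wait) Ψ (enc (afterJump (instrAt P pc′))) (Resumes (not β) pc′ c′)

  to-dispatch : ∀ {Ψ} β pc c ins R → map strip Ψ ↭ atBoundary β pc ins c ++ R → (stale : Stale β R) →
                Reaching (enc wait) Ψ (enc (round β dispatch))
                         (λ Ψ′ → map strip Ψ′ ↭ midRound β c (dispatchDue β pc ins c) (R ↓ᵗ))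
  to-dispatch β pc c ins R h stale =
    tick-step (nored-strip h (boundary-calm {β} {pc} {ins} {c} {R} stale))
    ▷ (λ { refl → fire wait (round β copy) (↭-trans (boundary-tick β pc ins c R h) (started-take β pc ins c (R ↓ᵗ))) })
    ▷ copy-all (total c) β pc ins c (R ↓ᵗ) c (λ _ → 0) refl (λ φ → +-identityʳ (c φ)) (Stale-↓ᵗ R stale)

  comparison : ∀ {Ψ} β pc c r z j R → Balanced c → map strip Ψ ↭ atBoundary β pc (dec r z j) c ++ R →
               (stale : Stale β R) → Comparison.Compared β pc r c (R ↓ᵗ) (Stale-↓ᵗ R stale) (enc wait) Ψ
  comparison β pc c r z j R bal h stale =
    Comparison.compare-up β pc r c (R ↓ᵗ) (Stale-↓ᵗ R stale) (c (down r)) (c (up r)) (bal r) (+-comm (c (up r)) (c (down r)))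
      (to-dispatch β pc c (dec r z j) R h stale
       ▷ λ h₁ → fire (round β dispatch) (round β (compare (up r))) (↭-trans h₁ (test-take β pc c r z j (R ↓ᵗ))))

  round-inc : ∀ {Ψ} β pc c r j R → instrAt P pc ≡ just (inc r j) → map strip Ψ ↭ atBoundary β pc (inc r j) c ++ R →
              Stale β R → Reaching (enc wait) Ψ (enc (afterJump (instrAt P j))) (Resumes (not β) j (increment c r))
  round-inc β pc c r j R eq h stale =
    to-dispatch β pc c (inc r j) R h stale
    ▷ λ h₁ → fire (round β dispatch) (instr β onInc pc) (↭-trans h₁ (perform-take β pc c r j (R ↓ᵗ)))
    ▷ finish β onInc pc j c (increment c r) (scheduled 0 (unit (not β) (up r))) (compareTokens β c) (R ↓ᵗ)
             (instrAt-< P pc eq) (cong (instrSpecs β onInc pc) eq) (units-put-scheduled (not β) c (up r))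
             (compareTokens-sourced β c) (Stale-↓ᵗ R stale)

  round-zero : ∀ {Ψ} β pc c r z j R → instrAt P pc ≡ just (dec r z j) → (stale : Stale β R) → lookup (registers c) r ≡ 0 →
               Comparison.Compared β pc r c (R ↓ᵗ) (Stale-↓ᵗ R stale) (enc wait) Ψ →
               Reaching (enc wait) Ψ (enc (afterJump (instrAt P z))) (Resumes (not β) z c)
  round-zero β pc c r z j R eq stale lk (isZero y down≡up reach) =
    reach
    ▷ λ h₁ → fire (round β (exhausted (up r))) (instr β onZero pc) (↭-trans h₁ (zeroExit-take β pc r c 0 y (R ↓ᵗ)))
    ▷ finish β onZero pc z c c [] (decExit β pc r ∷ compareRest β r c 0 y) (R ↓ᵗ)
             (instrAt-< P pc eq) (cong (instrSpecs β onZero pc) eq) ↭-refl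
             ((_ , refl) ∷ compareRest-sourced β r c 0 y) (Stale-↓ᵗ R stale)
  round-zero β pc c r z j R eq stale lk (isPositive x up≡ _) = ⊥-elim (0≢1+n (trans (sym lk) (lookup-registers-suc c r up≡)))

  round-dec : ∀ {Ψ n} β pc c r z j R → instrAt P pc ≡ just (dec r z j) → Balanced c → (stale : Stale β R) →
              lookup (registers c) r ≡ suc n → Comparison.Compared β pc r c (R ↓ᵗ) (Stale-↓ᵗ R stale) (enc wait) Ψ →
              RoundDone β Ψ (j , updateAt (registers c) r (λ _ → n))
  round-dec β pc c r z j R eq bal stale lk (isZero _ down≡up _) =
    ⊥-elim (0≢1+n (trans (sym (lookup-registers-zero c r down≡up)) lk))
  round-dec β pc c r z j R eq bal stale lk (isPositive x up≡ reach) =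
    decrement c r ,
    trans (cong (λ v → updateAt (registers c) r (λ _ → v)) (suc-injective (trans (sym lk) (lookup-registers-suc c r up≡))))
          (sym (registers-decrement c r up≡)) ,
    Balanced-decrement c r bal up≡ ,
    (reach
     ▷ λ h₁ → fire (round β (exhausted (down r))) (instr β onDec pc) (↭-trans h₁ (decExit-take β pc r c x 0 (R ↓ᵗ)))
     ▷ finish β onDec pc j c (decrement c r) (scheduled 0 (unit (not β) (down r))) (zeroExit β pc r ∷ compareRest β r c x 0)
              (R ↓ᵗ) (instrAt-< P pc eq) (cong (instrSpecs β onDec pc) eq) (units-put-scheduled (not β) c (down r))
              ((_ , refl) ∷ compareRest-sourced β r c x 0) (Stale-↓ᵗ R stale))

  round-step : ∀ {Ψ m′} β pc c ins R → instrAt P pc ≡ just ins → Balanced c →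
               map strip Ψ ↭ atBoundary β pc ins c ++ R → Stale β R → MStep P (pc , registers c) m′ → RoundDone β Ψ m′
  round-step β pc c ins R eq bal h stale (m-inc {r = r} {j} e) with trans (sym eq) e
  ... | refl = increment c r , sym (registers-increment c r bal) , Balanced-increment c r bal , round-inc β pc c r j R eq h stale
  round-step β pc c ins R eq bal h stale (m-zero {r = r} {z} {j} e lk) with trans (sym eq) e
  ... | refl = c , refl , bal , round-zero β pc c r z j R eq stale lk (comparison β pc c r z j R bal h stale)
  round-step β pc c ins R eq bal h stale (m-dec {r = r} {z} {j} e lk) with trans (sym eq) e
  ... | refl = round-dec β pc c r z j R eq bal stale lk (comparison β pc c r z j R bal h stale)

  nothing≢just : ∀ {i : Instr} → nothing ≢ just i
  nothing≢just ()

  MStep-defined : ∀ {pc v m′} → MStep P (pc , v) m′ → instrAt P pc ≢ nothing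
  MStep-defined (m-inc e)    eq = nothing≢just (trans (sym eq) e)
  MStep-defined (m-zero e _) eq = nothing≢just (trans (sym eq) e)
  MStep-defined (m-dec e _)  eq = nothing≢just (trans (sym eq) e)

  simulate : ∀ {m cf} → Star (MStep P) m cf → instrAt P (proj₁ cf) ≡ nothing →
             ∀ β c {Ψ} → proj₂ m ≡ registers c → Balanced c → Resumes β (proj₁ m) c Ψ →
             ∃ λ Ψ′ → Run ⟨ enc (afterJump (instrAt P (proj₁ m))) , nothing , Ψ ⟩ ⟨ enc halt , nothing , Ψ′ ⟩
  simulate ε stop β c {Ψ} regs bal (halted eq) =
    Ψ , subst (λ m → Run ⟨ enc (afterJump m) , nothing , Ψ ⟩ ⟨ enc halt , nothing , Ψ ⟩) (sym eq) ε
  simulate ε stop β c regs bal (waiting _ _ eq _ _) = ⊥-elim (nothing≢just (trans (sym stop) eq))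
  simulate (st ◅ _) stop β c refl bal (halted eq) = ⊥-elim (MStep-defined st eq)
  simulate {pc , _} (st ◅ rest) stop β c {Ψ} refl bal (waiting ins R eq h stale)
    with round-step β pc c ins R eq bal h stale st
  ... | c′ , regs′ , bal′ , reaching run resumes with simulate rest stop (not β) c′ regs′ bal′ resumes
  ... | Ψ′ , run′ = Ψ′ , subst (λ m → Run ⟨ enc (afterJump m) , nothing , Ψ ⟩ ⟨ enc halt , nothing , Ψ′ ⟩) (sym eq) (run ◅◅ run′)

  completeness : Halts P → Reachable simulator (enc halt)
  completeness (_ , mrun , stop) with call {[]} {boot} (here refl) (here refl) []
  ... | reaching run₀ e₀
    with simulate mrun stop false (λ _ → 0) refl (λ _ → z≤n) (jump-resumes true 0 (λ _ → 0) [] _ [] (↭-reflexive e₀))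
  ... | Ψ′ , run′ = Ψ′ , run₀ ◅◅ run′

open Simulation using (simulator; soundness; completeness)

theorem2 : Σ (Program → Contract × State) λ red →
    (P : Program) → IsTA (proj₁ (red P))
    × (Halts P ⇔ Reachable (proj₁ (red P)) (proj₂ (red P)))
theorem2 = (λ P → simulator P , enc halt) ,
           (λ P → compile-IsTA boot _ , mk⇔ (completeness P) (soundness P))
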